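{- Let $k$ be a positive integer and let $G$ be a finite simple $3$-degenerate graph with maximum degree $\Delta(G)\leq 2k-1$. Then $\chi'_l(G)\leq k$, i.e. $G$ has a $k$-linear coloring.
   Context: A graph is $t$-degenerate if every subgraph of it has a vertex of degree at most $t$ (equivalently, its vertices can be ordered so that each vertex has at most $t$ neighbors later in the ordering). A linear forest is a forest each of whose connected components is a path. A $k$-linear coloring of $G$ is a map $c:E(G)\to\{1,\dots,k\}$ such that each color class $c^{ -1}(i)$ forms a linear forest (i.e. every vertex is incident with at most two edges of each color and there is no monochromatic cycle). The linear arboricity $\chi'_l(G)$ is the minimum $k$ for which $G$ has a $k$-linear coloring. -}

module Defs where

open import Data.Nat using (ℕ; zero; suc; _+_; _*_; _∸_; _≤_)
open import Data.Bool using (Bool; true; false; if_then_else_; _∧_)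
open import Data.Fin using (Fin; _≟_)
open import Data.Fin.Subset using (Subset; _∈_; Nonempty)
open import Data.List using (List; []; _∷_; _++_; [_]; length; map; allFin; zip)
open import Data.Nat.ListAction using (sum)
open import Data.Vec using (lookup)
open import Data.List.Relation.Unary.All using (All)
open import Data.List.Relation.Unary.Unique.Propositional using (Unique)
open import Data.Product using (_×_; _,_; Σ; ∃-syntax)
open import Relation.Binary.PropositionalEquality using (_≡_)
open import Relation.Nullary using (¬_)
open import Relation.Nullary.Decidable using (⌊_⌋)

record Graph (n : ℕ) : Set where
  field
    adj   : Fin n → Fin n → Bool
    sym   : ∀ u v → adj u v ≡ adj v u
    irrefl : ∀ u → adj u u ≡ false
open Graph public

count : ∀ {n} → (Fin n → Bool) → ℕ
count {n} p = sum (map (λ v → if p v then 1 else 0) (allFin n))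

degree : ∀ {n} → Graph n → Fin n → ℕ
degree G u = count (λ v → adj G u v)

MaxDegree≤ : ∀ {n} → Graph n → ℕ → Set
MaxDegree≤ G d = ∀ u → degree G u ≤ d

degreeIn : ∀ {n} → Graph n → Subset n → Fin n → ℕ
degreeIn G S u = count (λ v → adj G u v ∧ lookup S v)

Degenerate : ∀ {n} → ℕ → Graph n → Set
Degenerate t G = ∀ S → Nonempty S → ∃[ u ] (u ∈ S × degreeIn G S u ≤ t)

-- Edge colorings with k colors: a symmetric map on vertex pairs
-- (only its values on edges matter).
record EdgeColoring {n} (G : Graph n) (k : ℕ) : Set where
  field
    col     : Fin n → Fin n → Fin k
    col-sym : ∀ u v → col u v ≡ col v u
open EdgeColoring public

colorDegree : ∀ {n k} {G : Graph n} → EdgeColoring G k → Fin k → Fin n → ℕ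
colorDegree {G = G} c i u = count (λ v → adj G u v ∧ ⌊ col c u v ≟ i ⌋)

cyclePairs : ∀ {A : Set} → List A → List (A × A)
cyclePairs [] = []
cyclePairs (x ∷ xs) = zip (x ∷ xs) (xs ++ [ x ])

MonoCycle : ∀ {n k} {G : Graph n} → EdgeColoring G k → Fin k → List (Fin n) → Set
MonoCycle {G = G} c i vs =
  (3 ≤ length vs) × Unique vs ×
  All (λ { (u , v) → adj G u v ≡ true × col c u v ≡ i }) (cyclePairs vs)

-- each color class is a linear forest
IsLinearColoring : ∀ {n k} {G : Graph n} → EdgeColoring G k → Set
IsLinearColoring {k = k} c =
  (∀ (i : Fin k) u → colorDegree c i u ≤ 2) ×
  (∀ (i : Fin k) vs → ¬ MonoCycle c i vs)

HasLinearColoring : ∀ {n} → Graph n → ℕ → Set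
HasLinearColoring G k = Σ (EdgeColoring G k) IsLinearColoring

{-# OPTIONS --safe #-}

-- Put 2m + 1 ≥ Δ, so that there are m + 1 colours, and induct on the number of non-isolated
-- vertices. By degeneracy some vertex x has a neighbour w of degree at most 3, and unless w has
-- degree at most 2 or x has degree at most 2m, also a second neighbour v of degree at most 3. Let p be
-- another neighbour of w, and colour G − w − vx by induction. A colour d that is available at p and
-- occurs at most once at v lets this colouring extend: give vx the colour d if d is missing at x,
-- and otherwise any possible colour. Since d then occurs at x, counting leaves another colour
-- available at x, and with distinct colours at x and p the three edges at w can be coloured. If v = p
-- or v is adjacent to p, such a d exists by counting. Otherwise colour G − w − vx + vp instead,
-- let d be the colour of vp, and delete vp again.
module Submission where

open import Defs
open import Data.Nat using (ℕ; zero; suc; _+_; _*_; _∸_; _≤_; _<_; _≤?_; _<?_; z≤n; s≤s; s≤s⁻¹)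
open import Data.Nat.Properties hiding (_≟_)
open import Data.Nat.Solver using (module +-*-Solver)
open import Data.Nat.ListAction using (sum)
open import Data.Bool using (Bool; true; false; if_then_else_; _∧_; _∨_; not)
open import Data.Bool.Properties using (∨-identityʳ; ∨-zeroʳ; ¬-not)
import Data.Bool as Bool
open import Data.Fin using (Fin; zero; suc; _≟_)
open import Data.Fin.Properties using (any?)
open import Data.Fin.Subset using (Subset) renaming (_∈_ to _∈ˢ_)
open import Data.Fin.Subset.Properties using (nonempty?)
open import Data.List using (List; []; _∷_; _++_; [_]; length; map; allFin; zip)
open import Data.List.Properties using (map-tabulate)
open import Data.List.Relation.Unary.All using (All; []; _∷_)
import Data.List.Relation.Unary.All as All
open import Data.List.Relation.Unary.All.Properties using (¬Any⇒All¬)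
open import Data.List.Relation.Unary.Any using (Any; here; there)
import Data.List.Relation.Unary.Any as Any
open import Data.List.Relation.Unary.AllPairs using (AllPairs; []; _∷_)
open import Data.List.Relation.Unary.Unique.Propositional using (Unique)
open import Data.List.Relation.Binary.Sublist.Propositional using (_⊆_; []; _∷_; _∷ʳ_)
open import Data.Vec using (tabulate; lookup)
open import Data.Vec.Properties using (lookup∘tabulate; lookup⇒[]=; []=⇒lookup)
open import Data.Product using (Σ; ∃-syntax; _×_; _,_; proj₁; proj₂)
open import Data.Sum using (_⊎_; inj₁; inj₂; [_,_]′)
open import Data.Empty using (⊥)
open import Data.Unit using (⊤; tt)
open import Function using (_∘_; id; case_of_)
open import Relation.Nullary using (¬_; Dec; yes; no; contradiction)
open import Relation.Nullary.Decidable using (⌊_⌋; ¬?; _×-dec_; _⊎-dec_)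
open import Relation.Binary.PropositionalEquality using (_≡_; _≢_; refl; cong; cong₂; subst; subst₂; trans; ≢-sym) renaming (sym to ≡-sym)

-- Sums and counts over Fin n

abstract
  ∑ : ∀ {n} → (Fin n → ℕ) → ℕ
  ∑ {n} f = sum (map f (allFin n))

  ∑-suc : ∀ {n} (f : Fin (suc n) → ℕ) → ∑ f ≡ f zero + ∑ (f ∘ suc)
  ∑-suc f = cong (λ l → f zero + sum l) (trans (map-tabulate suc f) (≡-sym (map-tabulate id (f ∘ suc))))

  ∑-mono : ∀ {n} {f g : Fin n → ℕ} → (∀ i → f i ≤ g i) → ∑ f ≤ ∑ g
  ∑-mono {n} {f} {g} f≤g = go (allFin n)
    where
    go : ∀ l → sum (map f l) ≤ sum (map g l)
    go []      = z≤n
    go (i ∷ l) = +-mono-≤ (f≤g i) (go l)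

  ∑-+ : ∀ {n} (f g : Fin n → ℕ) → ∑ (λ i → f i + g i) ≡ ∑ f + ∑ g
  ∑-+ {n} f g = go (allFin n)
    where
    interchange : ∀ a b c d → (a + b) + (c + d) ≡ (a + c) + (b + d)
    interchange = +-*-Solver.solve 4 (λ a b c d → (a :+ b) :+ (c :+ d) := (a :+ c) :+ (b :+ d)) refl
      where open +-*-Solver
    go : ∀ l → sum (map (λ i → f i + g i) l) ≡ sum (map f l) + sum (map g l)
    go []      = refl
    go (i ∷ l) = trans (cong (f i + g i +_) (go l)) (interchange (f i) (g i) _ _)

  ∑-const : ∀ n c → ∑ {n} (λ _ → c) ≡ n * c
  ∑-const zero    c = refl
  ∑-const (suc n) c = trans (∑-suc {n} (λ _ → c)) (cong (c +_) (∑-const n c))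

-- Every comparison of sums that changes a single term goes through this. The corrections `a` and
-- `b` are absorbed at the index `c`, and adding them on both sides avoids subtraction.
∑-shift : ∀ {n} {f g : Fin n → ℕ} c {a b} → f c + a ≤ g c + b →
          (∀ i → i ≢ c → f i ≤ g i) → ∑ f + a ≤ ∑ g + b
∑-shift {suc n} {f} {g} zero {a} {b} at off = begin
  ∑ f + a                        ≡⟨ cong (_+ a) (∑-suc f) ⟩
  f zero + ∑ (f ∘ suc) + a       ≡⟨ swap (f zero) (∑ (f ∘ suc)) a ⟩
  f zero + a + ∑ (f ∘ suc)       ≤⟨ +-mono-≤ at (∑-mono λ i → off (suc i) λ ()) ⟩
  g zero + b + ∑ (g ∘ suc)       ≡⟨ swap (g zero) (∑ (g ∘ suc)) b ⟨
  g zero + ∑ (g ∘ suc) + b       ≡⟨ cong (_+ b) (∑-suc g) ⟨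
  ∑ g + b                        ∎
  where
  open ≤-Reasoning
  swap : ∀ x y z → x + y + z ≡ x + z + y
  swap = +-*-Solver.solve 3 (λ x y z → x :+ y :+ z := x :+ z :+ y) refl
    where open +-*-Solver
∑-shift {suc n} {f} {g} (suc c) {a} {b} at off = begin
  ∑ f + a                        ≡⟨ cong (_+ a) (∑-suc f) ⟩
  f zero + ∑ (f ∘ suc) + a       ≡⟨ +-assoc (f zero) _ a ⟩
  f zero + (∑ (f ∘ suc) + a)     ≤⟨ +-mono-≤ (off zero λ ()) (∑-shift c at λ i i≢c → off (suc i) λ { refl → i≢c refl }) ⟩
  g zero + (∑ (g ∘ suc) + b)     ≡⟨ +-assoc (g zero) _ b ⟨
  g zero + ∑ (g ∘ suc) + b       ≡⟨ cong (_+ b) (∑-suc g) ⟨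
  ∑ g + b                        ∎
  where open ≤-Reasoning

∑-< : ∀ {n} {f g : Fin n → ℕ} → ∑ f < ∑ g → ∃[ i ] f i < g i
∑-< {f = f} {g} lt with any? (λ i → f i <? g i)
... | yes found = found
... | no none   = contradiction (∑-mono λ i → ≮⇒≥ λ fi<gi → none (i , fi<gi)) (<⇒≱ lt)

pigeonhole : ∀ {n} (f : Fin n → ℕ) c → ∑ f < n * c → ∃[ i ] f i < c
pigeonhole {n} f c lt = ∑-< (subst (∑ f <_) (≡-sym (∑-const n c)) lt)

term≤∑ : ∀ {n} (f : Fin n → ℕ) i → f i ≤ ∑ f
term≤∑ {n} f i = subst (λ s → s + f i ≤ ∑ f) (trans (∑-const n 0) (*-zeroʳ n))
  (≤-trans (∑-shift {f = λ _ → 0} {g = f} i {f i} {0} (m≤m+n (f i) 0) (λ _ _ → z≤n)) (≤-reflexive (+-identityʳ _)))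

two-terms≤∑ : ∀ {n} (f : Fin n → ℕ) {i j} → i ≢ j → f i + f j ≤ ∑ f
two-terms≤∑ f {i} {j} i≢j = begin
  f i + f j     ≤⟨ +-monoˡ-≤ (f j) (≤-trans (≤-reflexive fi≡) (term≤∑ f₀ i)) ⟩
  ∑ f₀ + f j    ≤⟨ ∑-shift {f = f₀} {g = f} j {f j} {0} at off ⟩
  ∑ f + 0       ≡⟨ +-identityʳ _ ⟩
  ∑ f           ∎
  where
  open ≤-Reasoning
  -- Erasing the term at `j` leaves the one at `i` in the sum; the erased term is then put back by
  -- `∑-shift`.
  f₀ : _ → ℕ
  f₀ t = if ⌊ t ≟ j ⌋ then 0 else f t
  fi≡ : f i ≡ f₀ i
  fi≡ with i ≟ j
  ... | yes i≡j = contradiction i≡j i≢j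
  ... | no _    = refl
  at : f₀ j + f j ≤ f j + 0
  at with j ≟ j
  ... | yes _ = m≤m+n (f j) 0
  ... | no j≢ = contradiction refl j≢
  off : ∀ t → t ≢ j → f₀ t ≤ f t
  off t t≢j with t ≟ j
  ... | yes _ = z≤n
  ... | no _  = ≤-refl

ind : Bool → ℕ
ind b = if b then 1 else 0

ind-mono : ∀ {a b} → (a ≡ true → b ≡ true) → ind a ≤ ind b
ind-mono {false}         _   = z≤n
ind-mono {true}  {true}  _   = ≤-refl
ind-mono {true}  {false} imp = case imp refl of λ ()

ind≤1 : ∀ b → ind b ≤ 1
ind≤1 false = z≤n
ind≤1 true  = ≤-refl

abstract
  count-mono : ∀ {n} {p q : Fin n → Bool} → (∀ v → p v ≡ true → q v ≡ true) → count p ≤ count q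
  count-mono p⇒q = ∑-mono λ v → ind-mono (p⇒q v)

  count-mono-bump : ∀ {n} {p q : Fin n → Bool} u →
                    (∀ v → v ≢ u → p v ≡ true → q v ≡ true) → count p ≤ suc (count q)
  count-mono-bump {p = p} {q} u p⇒q = begin
    count p        ≡⟨ +-identityʳ _ ⟨
    count p + 0    ≤⟨ ∑-shift {f = ind ∘ p} {g = ind ∘ q} u {0} {1} at (λ v v≢u → ind-mono (p⇒q v v≢u)) ⟩
    count q + 1    ≡⟨ +-comm _ 1 ⟩
    suc (count q)  ∎
    where
    open ≤-Reasoning
    at : ind (p u) + 0 ≤ ind (q u) + 1
    at = ≤-trans (≤-reflexive (+-identityʳ _)) (≤-trans (ind≤1 (p u)) (m≤n+m 1 _))

  count-mono-< : ∀ {n} {p q : Fin n → Bool} u → p u ≡ false → q u ≡ true →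
                 (∀ v → p v ≡ true → q v ≡ true) → count p < count q
  count-mono-< {p = p} {q} u pu qu p⇒q = begin
    suc (count p)  ≡⟨ +-comm 1 _ ⟩
    count p + 1    ≤⟨ ∑-shift {f = ind ∘ p} {g = ind ∘ q} u {1} {0} at (λ v _ → ind-mono (p⇒q v)) ⟩
    count q + 0    ≡⟨ +-identityʳ _ ⟩
    count q        ∎
    where
    open ≤-Reasoning
    at : ind (p u) + 1 ≤ ind (q u) + 0
    at rewrite pu | qu = ≤-refl

  count-< : ∀ {n} {p q : Fin n → Bool} → count p < count q → ∃[ v ] (p v ≡ false × q v ≡ true)
  count-< {p = p} {q} lt with ∑-< lt
  ... | v , lt′ = v , split (p v) (q v) lt′
    where
    split : ∀ a b → ind a < ind b → a ≡ false × b ≡ true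
    split false true  _        = refl , refl
    split true  true  (s≤s ())

  count-false : ∀ n → count {n} (λ _ → false) ≡ 0
  count-false n = trans (∑-const n 0) (*-zeroʳ n)

count-pos : ∀ {n} {p : Fin n → Bool} {v} → p v ≡ true → 0 < count p
count-pos {n} {p} {v} pv = subst (_< count p) (count-false n) (count-mono-< v refl pv λ _ ())

-- Adjoining `w` to `q` raises its count by at most one, so a gap of two still leaves an element.
count-<-avoiding : ∀ {n} {p q : Fin n → Bool} w → suc (count q) < count p →
                   ∃[ v ] (v ≢ w × q v ≡ false × p v ≡ true)
count-<-avoiding {p = p} {q} w lt with count-< {p = λ v → q v ∨ ⌊ v ≟ w ⌋} {p}
  (≤-trans (s≤s (count-mono-bump w drop)) lt)
  where
  drop : ∀ v → v ≢ w → q v ∨ ⌊ v ≟ w ⌋ ≡ true → q v ≡ true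
  drop v v≢w eq with q v | v ≟ w
  ... | true  | _       = refl
  ... | false | yes v≡w = contradiction v≡w v≢w
... | v , eq , pv with v ≟ w
...   | no v≢w = v , v≢w , trans (≡-sym (∨-identityʳ (q v))) eq , pv
...   | yes _  = case trans (≡-sym (∨-zeroʳ (q v))) eq of λ ()

-- Linear forests given by the order in which their edges are inserted

Edges : ℕ → Set
Edges n = List (Fin n × Fin n)

Joins : ∀ {n} → Fin n × Fin n → Fin n → Fin n → Set
Joins (a , b) u v = (a ≡ u × b ≡ v) ⊎ (a ≡ v × b ≡ u)

joins? : ∀ {n} (e : Fin n × Fin n) u v → Dec (Joins e u v)
joins? (a , b) u v = ((a ≟ u) ×-dec (b ≟ v)) ⊎-dec ((a ≟ v) ×-dec (b ≟ u))

Joins-sym : ∀ {n} (e : Fin n × Fin n) {u v} → Joins e u v → Joins e v u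
Joins-sym _ (inj₁ p) = inj₂ p
Joins-sym _ (inj₂ p) = inj₁ p

Joins-flip : ∀ {n} {a b u v : Fin n} → Joins (a , b) u v → Joins (b , a) u v
Joins-flip (inj₁ (p , q)) = inj₂ (q , p)
Joins-flip (inj₂ (p , q)) = inj₁ (q , p)

Joins-unique : ∀ {n} (e : Fin n × Fin n) {a b u v} → Joins e a b → Joins e u v → Joins (a , b) u v
Joins-unique _ (inj₁ (refl , refl)) j                    = j
Joins-unique _ (inj₂ (refl , refl)) (inj₁ (refl , refl)) = inj₂ (refl , refl)
Joins-unique _ (inj₂ (refl , refl)) (inj₂ (refl , refl)) = inj₁ (refl , refl)

Joined : ∀ {n} → Edges n → Fin n → Fin n → Set
Joined P u v = Any (λ e → Joins e u v) P

joined? : ∀ {n} (P : Edges n) u v → Dec (Joined P u v)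
joined? P u v = Any.any? (λ e → joins? e u v) P

Joined-sym : ∀ {n} {P : Edges n} {u v} → Joined P u v → Joined P v u
Joined-sym = Any.map λ {e} → Joins-sym e

δ : ∀ {n} → Fin n → Fin n → ℕ
δ a u = ind ⌊ a ≟ u ⌋

δ-refl : ∀ {n} (a : Fin n) → δ a a ≡ 1
δ-refl a with a ≟ a
... | yes _  = refl
... | no a≢a = contradiction refl a≢a

δ-≢ : ∀ {n} {a u : Fin n} → a ≢ u → δ a u ≡ 0
δ-≢ {a = a} {u} a≢u with a ≟ u
... | yes a≡u = contradiction a≡u a≢u
... | no _    = refl

deg : ∀ {n} → Edges n → Fin n → ℕ
deg []            u = 0
deg ((a , b) ∷ P) u = δ a u + δ b u + deg P u

deg-∷-≥ : ∀ {n} (e : Fin n × Fin n) P u → deg P u ≤ deg (e ∷ P) u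
deg-∷-≥ (a , b) P u = m≤n+m (deg P u) (δ a u + δ b u)

deg-∷-off : ∀ {n} {a b u : Fin n} P → a ≢ u → b ≢ u → deg ((a , b) ∷ P) u ≡ deg P u
deg-∷-off P a≢u b≢u rewrite δ-≢ a≢u | δ-≢ b≢u = refl

deg-∷-fst : ∀ {n} (a b : Fin n) P → suc (deg P a) ≤ deg ((a , b) ∷ P) a
deg-∷-fst a b P rewrite δ-refl a = s≤s (m≤n+m (deg P a) (δ b a))

deg-∷-snd : ∀ {n} (a b : Fin n) P → suc (deg P b) ≤ deg ((a , b) ∷ P) b
deg-∷-snd a b P rewrite δ-refl b | +-comm (δ a b) 1 = s≤s (m≤n+m (deg P b) (δ a b))

deg-∷-joins : ∀ {n} (e : Fin n × Fin n) P {u v} → Joins e u v → suc (deg P u) ≤ deg (e ∷ P) u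
deg-∷-joins (a , b) P (inj₁ (refl , _)) = deg-∷-fst a b P
deg-∷-joins (a , b) P (inj₂ (_ , refl)) = deg-∷-snd a b P

joined⇒deg-pos : ∀ {n} (P : Edges n) {u v} → Joined P u v → 1 ≤ deg P u
joined⇒deg-pos (e ∷ P)     (here j)  = ≤-trans (s≤s z≤n) (deg-∷-joins e P j)
joined⇒deg-pos (e ∷ P) {u} (there j) = ≤-trans (joined⇒deg-pos P j) (deg-∷-≥ e P u)

deg-⊆ : ∀ {n} {P Q : Edges n} → P ⊆ Q → ∀ u → deg P u ≤ deg Q u
deg-⊆ []                    u = z≤n
deg-⊆ {Q = _ ∷ Q} (e ∷ʳ s)  u = ≤-trans (deg-⊆ s u) (deg-∷-≥ e Q u)
deg-⊆ (_∷_ {x = a , b} refl s) u = +-monoʳ-≤ (δ a u + δ b u) (deg-⊆ s u)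

-- lab P labels the connected components of P, as in union-find: inserting (a , b) relabels
-- the component of a by the label of b.
lab : ∀ {n} → Edges n → Fin n → Fin n
lab []            x = x
lab ((a , b) ∷ P) x = if ⌊ lab P x ≟ lab P a ⌋ then lab P b else lab P x

lab-∷ : ∀ {n} (e : Fin n × Fin n) P {x y} → lab P x ≡ lab P y → lab (e ∷ P) x ≡ lab (e ∷ P) y
lab-∷ (a , b) P eq = cong (λ l → if ⌊ l ≟ lab P a ⌋ then lab P b else l) eq

lab-joins : ∀ {n} (a b : Fin n) P → lab ((a , b) ∷ P) a ≡ lab ((a , b) ∷ P) b
lab-joins a b P with lab P a ≟ lab P a | lab P b ≟ lab P a
... | no ≢  | _     = contradiction refl ≢
... | yes _ | yes _ = refl
... | yes _ | no _  = refl

lab-∷⁻ : ∀ {n} (a b : Fin n) P {x y} → lab ((a , b) ∷ P) x ≡ lab ((a , b) ∷ P) y →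
         lab P x ≡ lab P y ⊎ (lab P x ≡ lab P a × lab P y ≡ lab P b) ⊎ (lab P x ≡ lab P b × lab P y ≡ lab P a)
lab-∷⁻ a b P {x} {y} eq with lab P x ≟ lab P a | lab P y ≟ lab P a
... | yes p | yes q = inj₁ (trans p (≡-sym q))
... | yes p | no _  = inj₂ (inj₁ (p , ≡-sym eq))
... | no _  | yes q = inj₂ (inj₂ (eq , q))
... | no _  | no _  = inj₁ eq

-- More edges give coarser components. When the merge by a kept edge is what identifies `x` and `y`,
-- the larger list contains the same edge and connects them through `a` and `b`.
lab-⊆ : ∀ {n} {P Q : Edges n} → P ⊆ Q → ∀ {x y} → lab P x ≡ lab P y → lab Q x ≡ lab Q y
lab-⊆ []                           eq = eq
lab-⊆ {Q = _ ∷ Q} (e ∷ʳ s)         eq = lab-∷ e Q (lab-⊆ s eq)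
lab-⊆ {P = (a , b) ∷ P} {_ ∷ Q} (refl ∷ s) eq with lab-∷⁻ a b P eq
... | inj₁ same             = lab-∷ (a , b) Q (lab-⊆ s same)
... | inj₂ (inj₁ (xa , yb)) = trans (lab-∷ (a , b) Q (lab-⊆ s xa))
                                (trans (lab-joins a b Q) (≡-sym (lab-∷ (a , b) Q (lab-⊆ s yb))))
... | inj₂ (inj₂ (xb , ya)) = trans (lab-∷ (a , b) Q (lab-⊆ s xb))
                                (trans (≡-sym (lab-joins a b Q)) (≡-sym (lab-∷ (a , b) Q (lab-⊆ s ya))))

-- The head is the newest edge. Asking that each edge, when inserted, joins ends of two different
-- paths bounds the degrees and excludes cycles, and extending a colour class then needs a check of
-- the new edge only.
Linear : ∀ {n} → Edges n → Set
Linear []            = ⊤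
Linear ((a , b) ∷ P) = (deg P a ≤ 1 × deg P b ≤ 1 × lab P a ≢ lab P b) × Linear P

-- With fewer edges inserted before it, an edge meets smaller degrees and finer components, so the
-- inherited order remains valid.
Linear-⊆ : ∀ {n} {P Q : Edges n} → P ⊆ Q → Linear Q → Linear P
Linear-⊆ []         _         = tt
Linear-⊆ (e ∷ʳ s)   (_ , lin) = Linear-⊆ s lin
Linear-⊆ {P = (a , b) ∷ _} (refl ∷ s) ((da , db , l) , lin) =
  (≤-trans (deg-⊆ s a) da , ≤-trans (deg-⊆ s b) db , λ eq → l (lab-⊆ s eq)) , Linear-⊆ s lin

Linear⇒deg≤2 : ∀ {n} (P : Edges n) → Linear P → ∀ u → deg P u ≤ 2
Linear⇒deg≤2 []            _ u = z≤n
Linear⇒deg≤2 ((a , b) ∷ P) ((da , db , l) , lin) u with a ≟ u | b ≟ u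
... | yes refl | yes refl = contradiction refl l
... | yes refl | no _     = s≤s da
... | no _     | yes refl = s≤s db
... | no _     | no _     = Linear⇒deg≤2 P lin u

-- A merge affects `x` only if `x` already shared the label of an end of the new edge. That end has
-- positive degree, hence differs from `x`, and induction applies to the two of them.
isolated⇒lab≢ : ∀ {n} (P : Edges n) → Linear P → ∀ {x y} → x ≢ y → deg P x ≡ 0 → lab P x ≢ lab P y
isolated⇒lab≢ []            _           x≢y _    eq = x≢y eq
isolated⇒lab≢ ((a , b) ∷ P) (_ , lin) {x} x≢y d≡0 eq with lab-∷⁻ a b P eq
... | inj₁ same             = isolated⇒lab≢ P lin x≢y (n≤0⇒n≡0 (subst (deg P x ≤_) d≡0 (deg-∷-≥ (a , b) P x))) same
... | inj₂ (inj₁ (xa , _))  =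
  isolated⇒lab≢ P lin (λ { refl → <⇒≢ (≤-trans (s≤s z≤n) (deg-∷-fst a b P)) (≡-sym d≡0) })
    (n≤0⇒n≡0 (subst (deg P x ≤_) d≡0 (deg-∷-≥ (a , b) P x))) xa
... | inj₂ (inj₂ (xb , _))  =
  isolated⇒lab≢ P lin (λ { refl → <⇒≢ (≤-trans (s≤s z≤n) (deg-∷-snd a b P)) (≡-sym d≡0) })
    (n≤0⇒n≡0 (subst (deg P x ≤_) d≡0 (deg-∷-≥ (a , b) P x))) xb

-- A path has at most two ends. If the three vertices are spread over the two paths merged by the
-- newest edge, two of them lie on the same old path, where the attachment vertex was an end as
-- well.
¬three-leaves : ∀ {n} (P : Edges n) → Linear P → ∀ {x y z} → x ≢ y → x ≢ z → y ≢ z →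
                deg P x ≤ 1 → deg P y ≤ 1 → deg P z ≤ 1 → lab P x ≡ lab P y → lab P y ≡ lab P z → ⊥
¬three-leaves []            _ x≢y _ _ _ _ _ xy _ = x≢y xy
¬three-leaves {n} ((a , b) ∷ P) ((da , db , a≁b) , lin) {x} {y} {z} x≢y x≢z y≢z dx dy dz xy yz
  = sides (lab-∷⁻ a b P xy) (lab-∷⁻ a b P yz)
  where
  old : ∀ t → deg ((a , b) ∷ P) t ≤ 1 → deg P t ≤ 1
  old t = ≤-trans (deg-∷-≥ (a , b) P t)

  -- Here `s` is the attachment vertex. If `t` or `t′` is `s` itself, then `s` was isolated before
  -- the insertion and alone in its component; otherwise `t`, `t′` and `s` are three ends of one old
  -- path.
  one-per-side : ∀ s → suc (deg P s) ≤ deg ((a , b) ∷ P) s → deg P s ≤ 1 →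
                 ∀ {t t′} → t ≢ t′ → deg ((a , b) ∷ P) t ≤ 1 → deg ((a , b) ∷ P) t′ ≤ 1 →
                 lab P t ≡ lab P s → lab P t′ ≡ lab P s → ⊥
  one-per-side s grow ds {t} {t′} t≢t′ dt dt′ ts t′s with t ≟ s | t′ ≟ s
  ... | yes refl | _ =
    isolated⇒lab≢ P lin t≢t′ (n≤0⇒n≡0 (s≤s⁻¹ (≤-trans grow dt))) (≡-sym t′s)
  ... | no _ | yes refl =
    isolated⇒lab≢ P lin (≢-sym t≢t′) (n≤0⇒n≡0 (s≤s⁻¹ (≤-trans grow dt′))) (≡-sym ts)
  ... | no t≢s | no t′≢s =
    ¬three-leaves P lin t≢t′ t≢s t′≢s (old t dt) (old t′ dt′) ds (trans ts (≡-sym t′s)) t′s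

  at-a : ∀ {t t′} → t ≢ t′ → deg ((a , b) ∷ P) t ≤ 1 → deg ((a , b) ∷ P) t′ ≤ 1 →
         lab P t ≡ lab P a → lab P t′ ≡ lab P a → ⊥
  at-a = one-per-side a (deg-∷-fst a b P) da

  at-b : ∀ {t t′} → t ≢ t′ → deg ((a , b) ∷ P) t ≤ 1 → deg ((a , b) ∷ P) t′ ≤ 1 →
         lab P t ≡ lab P b → lab P t′ ≡ lab P b → ⊥
  at-b = one-per-side b (deg-∷-snd a b P) db

  Split : Fin n → Fin n → Set
  Split s t = lab P s ≡ lab P t ⊎ (lab P s ≡ lab P a × lab P t ≡ lab P b) ⊎ (lab P s ≡ lab P b × lab P t ≡ lab P a)

  sides : Split x y → Split y z → ⊥
  sides (inj₁ e) (inj₁ f) = ¬three-leaves P lin x≢y x≢z y≢z (old x dx) (old y dy) (old z dz) e f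
  sides (inj₁ e) (inj₂ (inj₁ (ya , _)))              = at-a x≢y dx dy (trans e ya) ya
  sides (inj₁ e) (inj₂ (inj₂ (yb , _)))              = at-b x≢y dx dy (trans e yb) yb
  sides (inj₂ (inj₁ (_ , yb))) (inj₁ e)              = at-b y≢z dy dz yb (trans (≡-sym e) yb)
  sides (inj₂ (inj₂ (_ , ya))) (inj₁ e)              = at-a y≢z dy dz ya (trans (≡-sym e) ya)
  sides (inj₂ (inj₁ (xa , _))) (inj₂ (inj₂ (_ , za))) = at-a x≢z dx dz xa za
  sides (inj₂ (inj₂ (xb , _))) (inj₂ (inj₁ (_ , zb))) = at-b x≢z dx dz xb zb
  sides (inj₂ (inj₁ (_ , yb))) (inj₂ (inj₁ (ya , _))) = a≁b (trans (≡-sym ya) yb)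
  sides (inj₂ (inj₂ (_ , ya))) (inj₂ (inj₂ (yb , _))) = a≁b (trans (≡-sym ya) yb)

-- Deleting an edge from a forest

remove : ∀ {n} → Fin n → Fin n → Edges n → Edges n
remove u v []      = []
remove u v (e ∷ P) with joins? e u v
... | yes _ = remove u v P
... | no _  = e ∷ remove u v P

remove-⊆ : ∀ {n} (u v : Fin n) P → remove u v P ⊆ P
remove-⊆ u v []      = []
remove-⊆ u v (e ∷ P) with joins? e u v
... | yes _ = e ∷ʳ remove-⊆ u v P
... | no _  = refl ∷ remove-⊆ u v P

joined-remove : ∀ {n} {u v a b : Fin n} P → Joined P a b → ¬ Joins (a , b) u v → Joined (remove u v P) a b
joined-remove {u = u} {v} (e ∷ P) (here j) a≁ with joins? e u v
... | yes j′ = contradiction (Joins-unique e j j′) a≁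
... | no _   = here j
joined-remove {u = u} {v} (e ∷ P) (there j) a≁ with joins? e u v
... | yes _ = joined-remove P j a≁
... | no _  = there (joined-remove P j a≁)

deg-remove : ∀ {n} {u v : Fin n} P → Joined P u v → suc (deg (remove u v P) u) ≤ deg P u
deg-remove {u = u} {v} ((a , b) ∷ P) J with joins? (a , b) u v | J
... | yes j | _       = ≤-trans (s≤s (deg-⊆ (remove-⊆ u v P) u)) (deg-∷-joins (a , b) P j)
... | no ¬j | here j  = contradiction j ¬j
... | no _  | there J′ =
  ≤-trans (≤-reflexive (≡-sym (+-suc (δ a u + δ b u) _))) (+-monoʳ-≤ (δ a u + δ b u) (deg-remove P J′))

remove-comm : ∀ {n} (u v : Fin n) P → remove u v P ≡ remove v u P
remove-comm u v []      = refl
remove-comm u v (e ∷ P) with joins? e u v | joins? e v u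
... | yes _ | yes _ = remove-comm u v P
... | yes j | no ¬j = contradiction (Joins-sym e j) ¬j
... | no ¬j | yes j = contradiction (Joins-sym e j) ¬j
... | no _  | no _  = cong (e ∷_) (remove-comm u v P)

∧-true : ∀ {a b} → a ∧ b ≡ true → a ≡ true × b ≡ true
∧-true {true} {true} _ = refl , refl

-- The head edge accounts for at most `δ a u` neighbours through `b` and `δ b u` through `a`.
-- Striking these out of `p` leaves neighbours that are joined to `u` by the tail.
count≤deg : ∀ {n} (P : Edges n) u {p : Fin n → Bool} → (∀ v → p v ≡ true → Joined P u v) → count p ≤ deg P u
count≤deg {n} [] u {p} joined = subst (count p ≤_) (count-false n) (count-mono λ v pv → case joined v pv of λ ())
count≤deg {n} ((a , b) ∷ P) u {p} joined = begin
  count p                              ≤⟨ strip p a b ⟩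
  δ a u + count p₁                     ≤⟨ +-monoʳ-≤ (δ a u) (strip p₁ b a) ⟩
  δ a u + (δ b u + count p₂)           ≤⟨ +-monoʳ-≤ (δ a u) (+-monoʳ-≤ (δ b u) (count≤deg P u joined′)) ⟩
  δ a u + (δ b u + deg P u)            ≡⟨ +-assoc (δ a u) _ _ ⟨
  δ a u + δ b u + deg P u              ∎
  where
  open ≤-Reasoning
  without : (Fin n → Bool) → Fin n → Fin n → Fin n → Bool
  without q s t v = q v ∧ not (⌊ s ≟ u ⌋ ∧ ⌊ t ≟ v ⌋)

  strip : ∀ q s t → count q ≤ δ s u + count (without q s t)
  strip q s t with s ≟ u
  ... | yes _ = count-mono-bump t keep
    where
    keep : ∀ v → v ≢ t → q v ≡ true → q v ∧ not (⌊ t ≟ v ⌋) ≡ true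
    keep v v≢t qv with t ≟ v
    ... | yes refl = contradiction refl v≢t
    ... | no _ rewrite qv = refl
  ... | no _  = count-mono keep
    where
    keep : ∀ v → q v ≡ true → q v ∧ true ≡ true
    keep v qv rewrite qv = refl

  p₁ p₂ : Fin n → Bool
  p₁ = without p a b
  p₂ = without p₁ b a

  excluded : ∀ s t v → not (⌊ s ≟ u ⌋ ∧ ⌊ t ≟ v ⌋) ≡ true → ¬ (s ≡ u × t ≡ v)
  excluded s t v eq (s≡u , t≡v) with s ≟ u | t ≟ v
  excluded s t v () _           | yes _ | yes _
  ... | no s≢u | _      = s≢u s≡u
  ... | yes _  | no t≢v = t≢v t≡v

  joined′ : ∀ v → p₂ v ≡ true → Joined P u v
  joined′ v eq with ∧-true {p₁ v} eq
  ... | p₁v , notba with ∧-true {p v} p₁v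
  ... | pv , notab with joined v pv
  ... | here (inj₁ ab)        = contradiction ab (excluded a b v notab)
  ... | here (inj₂ (av , bu)) = contradiction (bu , av) (excluded b a v notba)
  ... | there j               = j

joined⇒lab≡ : ∀ {n} (P : Edges n) {u v} → Joined P u v → lab P u ≡ lab P v
joined⇒lab≡ ((a , b) ∷ P) (here (inj₁ (refl , refl))) = lab-joins a b P
joined⇒lab≡ ((a , b) ∷ P) (here (inj₂ (refl , refl))) = ≡-sym (lab-joins a b P)
joined⇒lab≡ (e ∷ P)       (there j)                   = lab-∷ e P (joined⇒lab≡ P j)

-- Closed walks and the label along them

module _ {n : ℕ} where

  -- Leaving the last vertex `e` free permits induction along the walk; `cyclePairs (x ∷ xs)` is the
  -- closed case `walk x xs x`.
  walk : Fin n → List (Fin n) → Fin n → Edges n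
  walk x xs e = zip (x ∷ xs) (xs ++ [ e ])

  Distinct : Fin n × Fin n → Fin n × Fin n → Set
  Distinct (s , t) (s′ , t′) = ¬ Joins (s , t) s′ t′

  walk-sources : ∀ {Q : Fin n → Set} x xs e → All Q (x ∷ xs) → All (Q ∘ proj₁) (walk x xs e)
  walk-sources x []       e (qx ∷ _)  = qx ∷ []
  walk-sources x (y ∷ ys) e (qx ∷ qs) = qx ∷ walk-sources y ys e qs

  walk-avoids : ∀ {z} x xs e → All (z ≢_) (x ∷ xs) → z ≢ e →
                All (λ p → z ≢ proj₁ p × z ≢ proj₂ p) (walk x xs e)
  walk-avoids x []       e (zx ∷ _)       ze = (zx , ze) ∷ []
  walk-avoids x (y ∷ ys) e (zx ∷ zy ∷ zs) ze = (zx , zy) ∷ walk-avoids y ys e (zy ∷ zs) ze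

  path-distinct : ∀ x xs e → Unique (x ∷ xs) → All (_≢ e) (x ∷ xs) → AllPairs Distinct (walk x xs e)
  path-distinct x []       e _        _          = [] ∷ []
  path-distinct x (y ∷ ys) e (x∉ ∷ u) (xe ∷ ∉e) =
    All.map (λ { (xs , xt) (inj₁ (eq , _)) → xs eq ; (xs , xt) (inj₂ (eq , _)) → xt eq }) (walk-avoids y ys e x∉ xe)
    ∷ path-distinct y ys e u ∉e

  -- The first edge `xy` differs from `yz` because `x` is neither `y` nor `z`, and from all later
  -- ones because their sources avoid both `x` and `y`. Length two has to be excluded, since there
  -- the same edge is traversed back and forth.
  cycle-distinct : ∀ x xs → 2 ≤ length xs → Unique (x ∷ xs) → AllPairs Distinct (walk x xs x)
  cycle-distinct x (y ∷ z ∷ zs) _ (x∉@(_ ∷ x≢z ∷ x∉zs) ∷ uy@(y∉ ∷ _)) =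
    ((λ { (inj₁ (eq , _)) → All.head x∉ eq ; (inj₂ (eq , _)) → x≢z eq })
      ∷ All.zipWith (λ { (xs , ys) (inj₁ (eq , _)) → xs eq ; (xs , ys) (inj₂ (_ , eq)) → ys eq })
          (walk-sources z zs x (x≢z ∷ x∉zs) , walk-sources z zs x y∉))
    ∷ path-distinct y (z ∷ zs) x uy (All.map ≢-sym x∉)
  cycle-distinct x []       () _
  cycle-distinct x (_ ∷ []) (s≤s ()) _

  module _ (l : Fin n → Fin n) {a b : Fin n} where

    Crosses Preserves : Fin n × Fin n → Set
    Crosses   (s , t) = Joins (a , b) s t
    Preserves (s , t) = l s ≡ l t

    walk-preserves : ∀ x xs e → All Preserves (walk x xs e) → l x ≡ l e
    walk-preserves x []       e (p ∷ _)  = p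
    walk-preserves x (y ∷ ys) e (p ∷ ps) = trans p (walk-preserves y ys e ps)

    crosses-once : ∀ {p q} → Distinct p q → Crosses p → ¬ Crosses q
    crosses-once d (inj₁ (refl , refl)) c = d c
    crosses-once d (inj₂ (refl , refl)) c = d (Joins-flip c)

    -- The edge `ab` is traversed exactly once, as the edges of the walk are distinct. The label is
    -- constant before and after that moment, so the two ends of the walk carry the labels of `a`
    -- and `b`.
    walk-crossing : ∀ x xs e → AllPairs Distinct (walk x xs e) →
                    All (λ p → Crosses p ⊎ Preserves p) (walk x xs e) → Any Crosses (walk x xs e) →
                    (l x ≡ l a × l e ≡ l b) ⊎ (l x ≡ l b × l e ≡ l a)
    walk-crossing x [] e _ _ (here (inj₁ (refl , refl))) = inj₁ (refl , refl)
    walk-crossing x [] e _ _ (here (inj₂ (refl , refl))) = inj₂ (refl , refl)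
    walk-crossing x (y ∷ ys) e (d ∷ ds) (_ ∷ cps) (here c) = finish c
      where
      rest : l y ≡ l e
      rest = walk-preserves y ys e (All.zipWith (λ { (d′ , inj₁ c′) → contradiction c′ (crosses-once d′ c)
                                                   ; (d′ , inj₂ p)  → p }) (d , cps))
      finish : Joins (a , b) x y → (l x ≡ l a × l e ≡ l b) ⊎ (l x ≡ l b × l e ≡ l a)
      finish (inj₁ (refl , refl)) = inj₁ (refl , ≡-sym rest)
      finish (inj₂ (refl , refl)) = inj₂ (refl , ≡-sym rest)
    walk-crossing x (y ∷ ys) e (d ∷ ds) (inj₁ c ∷ cps) (there cs) =
      let (d′ , c′) = All.lookupAny d cs in contradiction c′ (crosses-once d′ c)
    walk-crossing x (y ∷ ys) e (d ∷ ds) (inj₂ p ∷ cps) (there cs) with walk-crossing y ys e ds cps cs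
    ... | inj₁ (q , r) = inj₁ (trans p q , r)
    ... | inj₂ (q , r) = inj₂ (trans p q , r)

-- The last inserted edge of a cycle would join two vertices with different labels, although the
-- rest of the cycle preserves the label.
Linear⇒acyclic : ∀ {n} (P : Edges n) → Linear P → ∀ vs → 3 ≤ length vs → Unique vs →
                 ¬ All (λ p → Joined P (proj₁ p) (proj₂ p)) (cyclePairs vs)
Linear⇒acyclic P _ [] () _ _
Linear⇒acyclic [] _ (x ∷ [])     _ _ (() ∷ _)
Linear⇒acyclic [] _ (x ∷ y ∷ xs) _ _ (() ∷ _)
Linear⇒acyclic ((a , b) ∷ P) ((_ , _ , a≁b) , lin) (x ∷ xs) 3≤ u js
  with Any.any? (λ p → joins? (a , b) (proj₁ p) (proj₂ p)) (walk x xs x)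
... | no none = Linear⇒acyclic P lin (x ∷ xs) 3≤ u
  (All.zipWith (λ { (¬j , here j) → contradiction j ¬j ; (_ , there j) → j }) (¬Any⇒All¬ _ none , js))
... | yes some with walk-crossing (lab P) x xs x (cycle-distinct x xs (s≤s⁻¹ 3≤) u)
                      (All.map (λ { (here j) → inj₁ j ; (there j) → inj₂ (joined⇒lab≡ P j) }) js) some
... | inj₁ (xa , xb) = a≁b (trans (≡-sym xa) xb)
... | inj₂ (xb , xa) = a≁b (trans (≡-sym xa) xb)

-- Graphs with one edge deleted or added

Adj : ∀ {n} → Graph n → Fin n → Fin n → Set
Adj G u v = adj G u v ≡ true

Adj-sym : ∀ {n} (G : Graph n) {u v} → Adj G u v → Adj G v u
Adj-sym G {u} {v} uv = trans (sym G v u) uv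

Adj⇒≢ : ∀ {n} (G : Graph n) {u v} → Adj G u v → u ≢ v
Adj⇒≢ G {u} uv refl = case trans (≡-sym uv) (irrefl G u) of λ ()

⌊⌋-cong : ∀ {A B : Set} (A? : Dec A) (B? : Dec B) → (A → B) → (B → A) → ⌊ A? ⌋ ≡ ⌊ B? ⌋
⌊⌋-cong (yes _) (yes _) _ _ = refl
⌊⌋-cong (yes a) (no ¬b) f _ = contradiction (f a) ¬b
⌊⌋-cong (no ¬a) (yes b) _ g = contradiction (g b) ¬a
⌊⌋-cong (no _)  (no _)  _ _ = refl

⌊⌋-true⁺ : ∀ {A : Set} (A? : Dec A) → A → ⌊ A? ⌋ ≡ true
⌊⌋-true⁺ (yes _) _ = refl
⌊⌋-true⁺ (no ¬a) a = contradiction a ¬a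

⌊⌋-true⁻ : ∀ {A : Set} (A? : Dec A) → ⌊ A? ⌋ ≡ true → A
⌊⌋-true⁻ (yes a) _ = a

joins?-flip : ∀ {n} (a b u v : Fin n) → ⌊ joins? (a , b) u v ⌋ ≡ ⌊ joins? (b , a) u v ⌋
joins?-flip a b u v = ⌊⌋-cong (joins? (a , b) u v) (joins? (b , a) u v) Joins-flip Joins-flip

abstract
  delete : ∀ {n} → Graph n → Fin n → Fin n → Graph n
  delete G u v .adj a b  = adj G a b ∧ not ⌊ joins? (a , b) u v ⌋
  delete G u v .sym a b  = cong₂ (λ p q → p ∧ not q) (sym G a b) (joins?-flip a b u v)
  delete G u v .irrefl a rewrite irrefl G a = refl

  link : ∀ {n} → Graph n → (u v : Fin n) → u ≢ v → Graph n
  link G u v u≢v .adj a b  = adj G a b ∨ ⌊ joins? (a , b) u v ⌋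
  link G u v u≢v .sym a b  = cong₂ _∨_ (sym G a b) (joins?-flip a b u v)
  link G u v u≢v .irrefl a rewrite irrefl G a with joins? (a , a) u v
  ... | no _                     = refl
  ... | yes (inj₁ (refl , refl)) = contradiction refl u≢v
  ... | yes (inj₂ (refl , refl)) = contradiction refl u≢v

  delete-adj⁺ : ∀ {n} (G : Graph n) {u v a b} → Adj G a b → ¬ Joins (a , b) u v → Adj (delete G u v) a b
  delete-adj⁺ G {u} {v} {a} {b} ab ¬j rewrite ab with joins? (a , b) u v
  ... | yes j = contradiction j ¬j
  ... | no _  = refl

  delete-adj⁻ : ∀ {n} (G : Graph n) {u v a b} → Adj (delete G u v) a b → Adj G a b × ¬ Joins (a , b) u v
  delete-adj⁻ G {u} {v} {a} {b} eq with ∧-true {adj G a b} eq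
  ... | ab , n with joins? (a , b) u v
  ...   | no ¬j = ab , ¬j

  link-adj⁺ : ∀ {n} (G : Graph n) {u v u≢v a b} → Adj G a b → Adj (link G u v u≢v) a b
  link-adj⁺ G ab rewrite ab = refl

  link-adj : ∀ {n} (G : Graph n) {u v u≢v} → Adj (link G u v u≢v) u v
  link-adj G {u} {v} with adj G u v | joins? (u , v) u v
  ... | true  | _     = refl
  ... | false | yes _ = refl
  ... | false | no ¬j = contradiction (inj₁ (refl , refl)) ¬j

  link-adj⁻ : ∀ {n} (G : Graph n) {u v u≢v a b} → Adj (link G u v u≢v) a b → Adj G a b ⊎ Joins (a , b) u v
  link-adj⁻ G {u} {v} {_} {a} {b} eq with adj G a b | joins? (a , b) u v
  ... | true  | _     = inj₁ refl
  ... | false | yes j = inj₂ j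

module _ {n : ℕ} (G : Graph n) where

  degree-delete-≤ : ∀ u v t → degree (delete G u v) t ≤ degree G t
  degree-delete-≤ u v t = count-mono {p = adj (delete G u v) t} {adj G t} λ s ts → proj₁ (delete-adj⁻ G {u} {v} ts)

  degree-delete-< : ∀ {u v t s} → Adj G t s → Joins (t , s) u v → degree (delete G u v) t < degree G t
  degree-delete-< {u} {v} {t} {s} ts j =
    count-mono-< {p = adj (delete G u v) t} {adj G t} s gone ts λ r tr → proj₁ (delete-adj⁻ G {u} {v} tr)
    where
    gone : adj (delete G u v) t s ≡ false
    gone = ¬-not λ eq → proj₂ (delete-adj⁻ G eq) j

  degree-delete-fst : ∀ {u v} → Adj G u v → degree (delete G u v) u < degree G u
  degree-delete-fst uv = degree-delete-< uv (inj₁ (refl , refl))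

  degree-delete-snd : ∀ {u v} → Adj G u v → degree (delete G u v) v < degree G v
  degree-delete-snd uv = degree-delete-< (Adj-sym G uv) (inj₂ (refl , refl))

  degree-link-≤ : ∀ {u v u≢v} t → degree (link G u v u≢v) t ≤ suc (degree G t)
  degree-link-≤ {u} {v} {u≢v} t = case t ≟ u of λ where
    (yes refl) → count-mono-bump {p = adj (link G u v u≢v) t} {adj G t} v λ s s≢v ts →
          [ id , (λ { (inj₁ (_ , s≡v)) → contradiction s≡v s≢v ; (inj₂ (t≡v , _)) → contradiction t≡v u≢v }) ]′ (link-adj⁻ G {u} {v} {u≢v} ts)
    (no t≢u) → count-mono-bump {p = adj (link G u v u≢v) t} {adj G t} u λ s s≢u ts →
          [ id , (λ { (inj₁ (t≡u , _)) → contradiction t≡u t≢u ; (inj₂ (_ , s≡u)) → contradiction s≡u s≢u }) ]′ (link-adj⁻ G {u} {v} {u≢v} ts)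

  degree-link-off : ∀ {u v u≢v t} → t ≢ u → t ≢ v → degree (link G u v u≢v) t ≤ degree G t
  degree-link-off {u} {v} {u≢v} {t} t≢u t≢v = count-mono {p = adj (link G u v u≢v) t} {adj G t} λ s ts →
    [ id , (λ { (inj₁ (t≡u , _)) → contradiction t≡u t≢u ; (inj₂ (t≡v , _)) → contradiction t≡v t≢v }) ]′ (link-adj⁻ G {u} {v} {u≢v} ts)

-- Colourings as families of linear forests

Classes : ℕ → ℕ → Set
Classes k n = Fin k → Edges n

load : ∀ {k n} → Classes k n → Fin n → ℕ
load F u = ∑ (λ c → deg (F c) u)

-- The bound `load≤` is the form in which the pigeonhole arguments use the degrees. Together with
-- `covers` it leaves no room for repeated or foreign edges in the classes.
record _Colours_ {k n : ℕ} (F : Classes k n) (G : Graph n) : Set where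
  field
    linear : ∀ c → Linear (F c)
    covers : ∀ {u v} → Adj G u v → ∃[ c ] Joined (F c) u v
    load≤  : ∀ u → load F u ≤ degree G u
open _Colours_

insert : ∀ {k n} → Classes k n → Fin k → Fin n × Fin n → Classes k n
insert F c e c′ = if ⌊ c ≟ c′ ⌋ then e ∷ F c′ else F c′

insert-same : ∀ {k n} (F : Classes k n) c e → insert F c e c ≡ e ∷ F c
insert-same F c e with c ≟ c
... | yes _ = refl
... | no c≢ = contradiction refl c≢

insert-other : ∀ {k n} (F : Classes k n) {c c′} e → c ≢ c′ → insert F c e c′ ≡ F c′
insert-other F {c} {c′} e c≢ with c ≟ c′
... | yes c≡ = contradiction c≡ c≢
... | no _   = refl

Joinable : ∀ {n} → Edges n → Fin n → Fin n → Set
Joinable P u v = deg P u ≤ 1 × deg P v ≤ 1 × lab P u ≢ lab P v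

module _ {k n : ℕ} {F : Classes k n} {G : Graph n} where

  colours-insert : ∀ {u v c} → F Colours delete G u v → Adj G u v → Joinable (F c) u v →
                   insert F c (u , v) Colours G
  colours-insert {u} {v} {c} col uv joinable = record { linear = lin ; covers = cov ; load≤ = ld }
    where
    F′ : Classes k n
    F′ = insert F c (u , v)

    lin : ∀ c′ → Linear (F′ c′)
    lin c′ with c ≟ c′
    ... | yes refl = joinable , linear col c
    ... | no _     = linear col c′

    grow : ∀ c′ {a b} → Joined (F c′) a b → Joined (F′ c′) a b
    grow c′ j with c ≟ c′
    ... | yes _ = there j
    ... | no _  = j

    cov : ∀ {a b} → Adj G a b → ∃[ c′ ] Joined (F′ c′) a b
    cov {a} {b} ab with joins? (a , b) u v
    ... | yes (inj₁ (refl , refl)) = c , subst (λ P → Joined P u v) (≡-sym (insert-same F c _)) (here (inj₁ (refl , refl)))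
    ... | yes (inj₂ (refl , refl)) = c , subst (λ P → Joined P v u) (≡-sym (insert-same F c _)) (here (inj₂ (refl , refl)))
    ... | no ¬j with covers col (delete-adj⁺ G ab ¬j)
    ...   | c′ , j = c′ , grow c′ j

    drop : ∀ t → degree (delete G u v) t + (δ u t + δ v t) ≤ degree G t
    drop t with u ≟ t | v ≟ t
    ... | yes refl | yes refl = contradiction refl (Adj⇒≢ G uv)
    ... | yes refl | no _     = subst (_≤ degree G t) (+-comm 1 _) (degree-delete-fst G uv)
    ... | no _     | yes refl = subst (_≤ degree G t) (+-comm 1 _) (degree-delete-snd G uv)
    ... | no _     | no _     = subst (_≤ degree G t) (≡-sym (+-identityʳ _)) (degree-delete-≤ G u v t)

    ld : ∀ t → load F′ t ≤ degree G t
    ld t = begin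
      load F′ t                                        ≡⟨ +-identityʳ _ ⟨
      load F′ t + 0                                    ≤⟨ ∑-shift {f = λ c′ → deg (F′ c′) t} {λ c′ → deg (F c′) t} c {0} {δ u t + δ v t} at off ⟩
      load F t + (δ u t + δ v t)                       ≤⟨ +-monoˡ-≤ _ (load≤ col t) ⟩
      degree (delete G u v) t + (δ u t + δ v t)        ≤⟨ drop t ⟩
      degree G t                                       ∎
      where
      open ≤-Reasoning
      at : deg (F′ c) t + 0 ≤ deg (F c) t + (δ u t + δ v t)
      at = ≤-reflexive (trans (+-identityʳ _) (trans (cong (λ P → deg P t) (insert-same F c _)) (+-comm (δ u t + δ v t) _)))
      off : ∀ c′ → c′ ≢ c → deg (F′ c′) t ≤ deg (F c′) t
      off c′ c′≢c = ≤-reflexive (cong (λ P → deg P t) (insert-other F _ (≢-sym c′≢c)))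

  -- At `u` and at `v` the removal takes away at least one entry, which offsets the one that `link`
  -- added to the degree. As `uv` is not an edge of `G`, no edge that must be covered is lost.
  colours-unlink : ∀ {u v u≢v} → F Colours link G u v u≢v → ¬ Adj G u v → (λ c → remove u v (F c)) Colours G
  colours-unlink {u} {v} {u≢v} col ¬uv = record
    { linear = λ c → Linear-⊆ (remove-⊆ u v (F c)) (linear col c)
    ; covers = cov
    ; load≤  = ld }
    where
    F′ : Classes k n
    F′ c = remove u v (F c)

    cov : ∀ {a b} → Adj G a b → ∃[ c ] Joined (F′ c) a b
    cov {a} {b} ab with covers col (link-adj⁺ G {u≢v = u≢v} ab)
    ... | c , j = c , joined-remove (F c) j λ { (inj₁ (refl , refl)) → ¬uv ab ; (inj₂ (refl , refl)) → ¬uv (Adj-sym G ab) }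

    shrink : ∀ t c → deg (F′ c) t ≤ deg (F c) t
    shrink t c = deg-⊆ (remove-⊆ u v (F c)) t

    end : ∀ t c → suc (deg (F′ c) t) ≤ deg (F c) t → load F′ t ≤ degree G t
    end t c lt = s≤s⁻¹ (begin
      suc (load F′ t)        ≡⟨ +-comm 1 _ ⟩
      load F′ t + 1          ≤⟨ ∑-shift {f = λ c′ → deg (F′ c′) t} {λ c′ → deg (F c′) t} c {1} {0} (subst₂ _≤_ (+-comm 1 _) (≡-sym (+-identityʳ _)) lt) (λ c′ _ → shrink t c′) ⟩
      load F t + 0           ≡⟨ +-identityʳ _ ⟩
      load F t               ≤⟨ load≤ col t ⟩
      degree (link G u v u≢v) t ≤⟨ degree-link-≤ G {u≢v = u≢v} t ⟩
      suc (degree G t)       ∎)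
      where open ≤-Reasoning

    ld : ∀ t → load F′ t ≤ degree G t
    ld t with covers col (link-adj G {u≢v = u≢v}) | t ≟ u | t ≟ v
    ... | c , j | yes refl | _        = end u c (deg-remove (F c) j)
    ... | c , j | no _     | yes refl =
      end v c (subst (λ P → suc (deg P v) ≤ deg (F c) v) (remove-comm v u (F c)) (deg-remove (F c) (Joined-sym j)))
    ... | c , j | no t≢u   | no t≢v   =
      ≤-trans (∑-mono (shrink t)) (≤-trans (load≤ col t) (degree-link-off G {u≢v = u≢v} t≢u t≢v))

-- Finding a colour by counting

module _ {m n : ℕ} {F : Classes (suc m) n} where

  -- If every colour is used at least twice at u and v together, then the loads add up to
  -- 2 (m + 1); a colour used at most once there is missing at u or at v.
  greedy : (∀ c → Linear (F c)) → ∀ {u v} → u ≢ v → load F u + load F v < suc m * 2 →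
           ∃[ c ] Joinable (F c) u v
  greedy lin {u} {v} u≢v lt
    with pigeonhole (λ c → deg (F c) u + deg (F c) v) 2
           (subst (_< suc m * 2) (≡-sym (∑-+ (λ c → deg (F c) u) (λ c → deg (F c) v))) lt)
  ... | c , lt′ with deg (F c) u in du | deg (F c) v in dv
  ... | zero  | d     = c , subst (_≤ 1) (≡-sym du) z≤n , subst (_≤ 1) (≡-sym dv) (s≤s⁻¹ lt′) ,
                        isolated⇒lab≢ (F c) (lin c) u≢v du
  ... | suc d | zero  = c , subst (_≤ 1) (≡-sym du) (≤-trans (m≤m+n (suc d) 0) (s≤s⁻¹ lt′)) , subst (_≤ 1) (≡-sym dv) z≤n ,
                        λ eq → isolated⇒lab≢ (F c) (lin c) (≢-sym u≢v) dv (≡-sym eq)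
  ... | suc d | suc d′ = contradiction (≤-trans (s≤s (≤-reflexive (≡-sym (+-suc d d′)))) (s≤s⁻¹ lt′)) λ { (s≤s ()) }

  -- If each of the `m` colours other than `d` occurs at least twice at `u`, they exhaust the load
  -- `m * 2` and nothing remains for `d`.
  spare-colour : ∀ {u} → load F u ≤ m * 2 → ∀ d → (∃[ e ] (e ≢ d × deg (F e) u ≤ 1)) ⊎ deg (F d) u ≡ 0
  spare-colour {u} ld d with any? (λ e → ¬? (e ≟ d) ×-dec (deg (F e) u ≤? 1))
  ... | yes found = inj₁ found
  ... | no none   = inj₂ (n≤0⇒n≡0 (+-cancelˡ-≤ (suc m * 2) _ _ (begin
      suc m * 2 + deg (F d) u      ≡⟨ cong (_+ deg (F d) u) (∑-const (suc m) 2) ⟨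
      ∑ {suc m} (λ _ → 2) + deg (F d) u ≤⟨ ∑-shift d (≤-reflexive (+-comm 2 _)) (λ e e≢d → ≰⇒> λ le → none (e , e≢d , le)) ⟩
      load F u + 2                 ≤⟨ +-monoˡ-≤ 2 ld ⟩
      m * 2 + 2                    ≡⟨ +-comm (m * 2) 2 ⟩
      suc m * 2                    ≡⟨ +-identityʳ _ ⟨
      suc m * 2 + 0                ∎)))
    where open ≤-Reasoning

-- Extending a colouring to a vertex of degree at most three

Joins-star : ∀ {n} {w x y : Fin n} → w ≢ x → x ≢ y → ¬ Joins (w , x) w y
Joins-star w≢x x≢y (inj₁ (_ , x≡y)) = x≢y x≡y
Joins-star w≢x x≢y (inj₂ (_ , x≡w)) = w≢x (≡-sym x≡w)

joinable-isolated : ∀ {n} (P : Edges n) {w y} → Linear P → deg P w ≡ 0 → w ≢ y → deg P y ≤ 1 → Joinable P w y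
joinable-isolated P lin dw w≢y dy = ≤-trans (≤-reflexive dw) z≤n , dy , isolated⇒lab≢ P lin w≢y dw

-- Once the isolated vertex `w` is hung on `x`, it belongs to the component of `x`. A second edge
-- `wy` of the same colour is therefore safe when `x` and `y` lie in different components.
joinable-leaf : ∀ {n} (P : Edges n) {w x y} → Linear P → deg P w ≡ 0 → w ≢ x → w ≢ y → x ≢ y →
                deg P y ≤ 1 → lab P x ≢ lab P y → Joinable ((w , x) ∷ P) w y
joinable-leaf P {w} {x} {y} lin dw w≢x w≢y x≢y dy l = dw′ , dy′ , l′
  where
  dw′ : deg ((w , x) ∷ P) w ≤ 1
  dw′ rewrite δ-refl w | δ-≢ (≢-sym w≢x) | dw = ≤-refl
  dy′ : deg ((w , x) ∷ P) y ≤ 1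
  dy′ = subst (_≤ 1) (≡-sym (deg-∷-off P w≢y x≢y)) dy
  l′ : lab ((w , x) ∷ P) w ≢ lab ((w , x) ∷ P) y
  l′ eq with lab-∷⁻ w x P eq
  ... | inj₁ wy             = isolated⇒lab≢ P lin w≢y dw wy
  ... | inj₂ (inj₁ (_ , yx)) = l (≡-sym yx)
  ... | inj₂ (inj₂ (wx , _)) = isolated⇒lab≢ P lin w≢x dw wx

deg-insert-≥ : ∀ {k n} (F : Classes k n) c e d u → deg (F d) u ≤ deg (insert F c e d) u
deg-insert-≥ F c e d u with c ≟ d
... | yes _ = deg-∷-≥ e (F d) u
... | no _  = ≤-refl

deg-insert-≤ : ∀ {k n} (F : Classes k n) c a b d u → deg (insert F c (a , b) d) u ≤ δ a u + δ b u + deg (F d) u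
deg-insert-≤ F c a b d u with c ≟ d
... | yes _ = ≤-refl
... | no _  = m≤n+m _ (δ a u + δ b u)

Colourable : ∀ {n} → ℕ → Graph n → Set
Colourable {n} k G = Σ (Classes k n) (_Colours G)

abstract
  insert-greedily : ∀ {m n} {F : Classes (suc m) n} (G : Graph n) {u v} → F Colours delete G u v → Adj G u v →
                    load F u + load F v < suc m * 2 →
                    ∃[ c ] insert F c (u , v) Colours G
  insert-greedily G col uv lt =
    let (c , joinable) = greedy (linear col) (Adj⇒≢ G uv) lt in c , colours-insert col uv joinable

module Star {m n : ℕ} (G : Graph n) (maxdeg : ∀ u → degree G u ≤ suc (m * 2))
            {w x p q : Fin n} (wx : Adj G w x) (wp : Adj G w p) (wq : Adj G w q)
            (x≢p : x ≢ p) (x≢q : x ≢ q) (p≢q : p ≢ q) (dw : degree G w ≤ 3) where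

  -- The edges at `w` are taken off in the order `wq`, `wp`, `wx` and put back in the opposite
  -- order. As `w` has degree at most three, it is isolated in `H`.
  H₁ H₂ H : Graph n
  H₁ = delete G w q
  H₂ = delete H₁ w p
  H  = delete H₂ w x

  w≢x : w ≢ x
  w≢x = Adj⇒≢ G wx
  w≢p : w ≢ p
  w≢p = Adj⇒≢ G wp
  w≢q : w ≢ q
  w≢q = Adj⇒≢ G wq

  H₁-wp : Adj H₁ w p
  H₁-wp = delete-adj⁺ G wp (Joins-star w≢p p≢q)

  H₂-wx : Adj H₂ w x
  H₂-wx = delete-adj⁺ H₁ (delete-adj⁺ G wx (Joins-star w≢x x≢q)) (Joins-star w≢x x≢p)

  H-adj : ∀ {u v} → u ≢ w → v ≢ w → Adj G u v → Adj H u v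
  H-adj {u} {v} u≢w v≢w uv = delete-adj⁺ H₂ (delete-adj⁺ H₁ (delete-adj⁺ G uv (off q)) (off p)) (off x)
    where
    off : ∀ t → ¬ Joins (u , v) w t
    off t (inj₁ (u≡w , _)) = u≢w u≡w
    off t (inj₂ (_ , v≡w)) = v≢w v≡w

  H-adj⁻ : ∀ {u v} → Adj H u v → Adj G u v
  H-adj⁻ uv = proj₁ (delete-adj⁻ G (proj₁ (delete-adj⁻ H₁ (proj₁ (delete-adj⁻ H₂ uv)))))

  H₁-degree-w : degree H₁ w ≤ 2
  H₁-degree-w = s≤s⁻¹ (≤-trans (degree-delete-fst G wq) dw)
  H₂-degree-w : degree H₂ w ≤ 1
  H₂-degree-w = s≤s⁻¹ (≤-trans (degree-delete-fst H₁ H₁-wp) H₁-degree-w)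
  H-degree-w : degree H w ≤ 0
  H-degree-w = s≤s⁻¹ (≤-trans (degree-delete-fst H₂ H₂-wx) H₂-degree-w)

  H₁-degree≤ : ∀ t → degree H₁ t ≤ degree G t
  H₁-degree≤ = degree-delete-≤ G w q
  H₂-degree≤ : ∀ t → degree H₂ t ≤ degree G t
  H₂-degree≤ t = ≤-trans (degree-delete-≤ H₁ w p t) (H₁-degree≤ t)
  H-degree≤ : ∀ t → degree H t ≤ degree G t
  H-degree≤ t = ≤-trans (degree-delete-≤ H₂ w x t) (H₂-degree≤ t)

  H-degree-x : degree H x < degree G x
  H-degree-x = ≤-trans (degree-delete-snd H₂ H₂-wx) (H₂-degree≤ x)
  H₂-degree-p : degree H₂ p < degree G p
  H₂-degree-p = ≤-trans (degree-delete-snd H₁ H₁-wp) (H₁-degree≤ p)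
  H-degree-p : degree H p < degree G p
  H-degree-p = ≤-trans (s≤s (degree-delete-≤ H₂ w x p)) H₂-degree-p
  H₁-degree-q : degree H₁ q < degree G q
  H₁-degree-q = degree-delete-snd G wq
  H-degree-q : degree H q < degree G q
  H-degree-q = ≤-trans (s≤s (≤-trans (degree-delete-≤ H₂ w x q) (degree-delete-≤ H₁ w p q))) H₁-degree-q

  below-max : ∀ {d} t → d < degree G t → d ≤ m * 2
  below-max t lt = s≤s⁻¹ (≤-trans lt (maxdeg t))

  -- The edge `wq` comes last and is the critical one: `w` already has load at most two, so `q` may
  -- have load at most `m * 2 ∸ 1`, which is what the degree bound on `q` gives.
  extend-slack : {F : Classes (suc m) n} → F Colours H → degree G q ≤ m * 2 → Colourable (suc m) G
  extend-slack {F} col dq = _ , proj₂ (insert-greedily G (proj₂ col₁) wq load₁)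
    where
    col₂ : ∃[ c ] insert F c (w , x) Colours H₂
    col₂ = insert-greedily H₂ col H₂-wx (s≤s (+-mono-≤ {y = 1}
      (≤-trans (load≤ col w) (≤-trans H-degree-w z≤n)) (≤-trans (load≤ col x) (below-max x H-degree-x))))

    F₂ : Classes (suc m) n
    F₂ = insert F (proj₁ col₂) (w , x)

    col₁ : ∃[ c ] insert F₂ c (w , p) Colours H₁
    col₁ = insert-greedily H₁ (proj₂ col₂) H₁-wp (s≤s (+-mono-≤ {y = 1}
      (≤-trans (load≤ (proj₂ col₂) w) H₂-degree-w) (≤-trans (load≤ (proj₂ col₂) p) (below-max p H₂-degree-p))))

    F₁ : Classes (suc m) n
    F₁ = insert F₂ (proj₁ col₁) (w , p)

    load₁ : load F₁ w + load F₁ q < suc m * 2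
    load₁ = s≤s (begin
      load F₁ w + load F₁ q  ≤⟨ +-mono-≤ (≤-trans (load≤ (proj₂ col₁) w) H₁-degree-w) (load≤ (proj₂ col₁) q) ⟩
      2 + degree H₁ q        ≤⟨ s≤s (≤-trans H₁-degree-q dq) ⟩
      1 + m * 2              ∎)
      where open ≤-Reasoning

  module _ {F : Classes (suc m) n} (col : F Colours H) where

    isolated-w : ∀ c → deg (F c) w ≡ 0
    isolated-w c = n≤0⇒n≡0 (≤-trans (term≤∑ (λ c → deg (F c) w) c) (≤-trans (load≤ col w) H-degree-w))

    lin : ∀ c → Linear (F c)
    lin = linear col

    Apart : Fin (suc m) → Fin (suc m) → Fin n → Fin n → Set
    Apart a b s t = a ≡ b → lab (F a) s ≢ lab (F a) t

    -- The colours `a`, `b`, `c` go to `wx`, `wp`, `wq`. Since `w` starts isolated, a cycle can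
    -- arise only from two edges of equal colour whose far ends are already connected in it, and the
    -- degree of `w` is exceeded only if all three colours agree.
    insert-three : ∀ {a b c} → deg (F a) x ≤ 1 → deg (F b) p ≤ 1 → deg (F c) q ≤ 1 →
                   Apart a b x p → Apart a c x q → Apart b c p q → ¬ (a ≡ b × b ≡ c) → Colourable (suc m) G
    insert-three {a} {b} {c} sx sp sq xp xq pq ¬abc = _ , colours-insert col₁ wq joinable₃
      where
      F₂ F₁ : Classes (suc m) n
      F₂ = insert F a (w , x)
      F₁ = insert F₂ b (w , p)

      col₂ : F₂ Colours H₂
      col₂ = colours-insert col H₂-wx (joinable-isolated (F a) (lin a) (isolated-w a) w≢x sx)

      joinable₂ : Joinable (F₂ b) w p
      joinable₂ with a ≟ b
      ... | yes refl = joinable-leaf (F a) (lin a) (isolated-w a) w≢x w≢p x≢p sp (xp refl)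
      ... | no _     = joinable-isolated (F b) (lin b) (isolated-w b) w≢p sp

      col₁ : F₁ Colours H₁
      col₁ = colours-insert col₂ H₁-wp joinable₂

      joinable₃ : Joinable (F₁ c) w q
      joinable₃ with b ≟ c | a ≟ c
      ... | yes b≡c | yes a≡c = contradiction (trans a≡c (≡-sym b≡c) , b≡c) ¬abc
      ... | yes refl | no _    = joinable-leaf (F b) (lin b) (isolated-w b) w≢p w≢q p≢q sq (pq refl)
      ... | no _    | yes refl = joinable-leaf (F a) (lin a) (isolated-w a) w≢x w≢q x≢q sq (xq refl)
      ... | no _    | no _    = joinable-isolated (F c) (lin c) (isolated-w c) w≢q sq

    distinct : ∀ {a b s t} → a ≢ b → Apart a b s t
    distinct a≢b a≡b = contradiction a≡b a≢b

    slot : ∀ {c t} → deg (F c) t ≡ 0 → deg (F c) t ≤ 1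
    slot d≡0 = ≤-trans (≤-reflexive d≡0) z≤n

    spare : ∀ t → degree H t < degree G t → ∀ d → (∃[ e ] (e ≢ d × deg (F e) t ≤ 1)) ⊎ deg (F d) t ≡ 0
    spare t lt = spare-colour {F = F} (≤-trans (load≤ col t) (below-max t lt))

    -- The only obstruction to reusing d or e at q is that q ends the d-path from p and the
    -- e-path from x; then x can take any spare colour, since the d-path has no third end.
    extend-distinct : ∀ {e d} → e ≢ d → deg (F e) x ≤ 1 → deg (F d) p ≤ 1 → Colourable (suc m) G
    extend-distinct {e} {d} e≢d sx sp with spare q H-degree-q d
    ... | inj₂ d≡0 = insert-three sx sp (slot d≡0) (distinct e≢d) (distinct e≢d)
                       (λ _ eq → isolated⇒lab≢ (F d) (lin d) (≢-sym p≢q) d≡0 (≡-sym eq)) λ (e≡d , _) → e≢d e≡d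
    ... | inj₁ (g , g≢d , sg) with g ≟ e
    ...   | no g≢e   = insert-three sx sp sg (distinct e≢d) (distinct (≢-sym g≢e)) (distinct (≢-sym g≢d)) λ (e≡d , _) → e≢d e≡d
    ...   | yes refl with lab (F e) x ≟ lab (F e) q
    ...     | no xq  = insert-three sx sp sg (distinct e≢d) (λ _ → xq) (distinct (≢-sym e≢d)) λ (e≡d , _) → e≢d e≡d
    ...     | yes xq with spare q H-degree-q e
    ...       | inj₂ e≡0 = contradiction (≡-sym xq) (isolated⇒lab≢ (F e) (lin e) (≢-sym x≢q) e≡0)
    ...       | inj₁ (f , f≢e , sf) with f ≟ d
    ...         | no f≢d   = insert-three sx sp sf (distinct e≢d) (distinct (≢-sym f≢e)) (distinct (≢-sym f≢d)) λ (e≡d , _) → e≢d e≡d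
    ...         | yes refl with lab (F d) p ≟ lab (F d) q
    ...           | no pq  = insert-three sx sp sf (distinct e≢d) (distinct e≢d) (λ _ → pq) λ (e≡d , _) → e≢d e≡d
    ...           | yes pq with spare x H-degree-x e
    ...             | inj₂ e≡0 = contradiction xq (isolated⇒lab≢ (F e) (lin e) x≢q e≡0)
    ...             | inj₁ (h , h≢e , sh) = insert-three sh sp sg
                        (λ { refl xp → ¬three-leaves (F d) (lin d) x≢p x≢q p≢q sh sp sf xp pq })
                        (distinct h≢e) (distinct (≢-sym e≢d)) λ (_ , d≡e) → e≢d (≡-sym d≡e)

  -- vx is coloured so that d occurs at x; then spare-colour at x must yield a colour other than d.
  extend-through : ∀ {v} {F : Classes (suc m) n} → F Colours delete H v x → Adj G v x → v ≢ w →
                   degree (delete H v x) v ≤ 2 → ∀ d → deg (F d) v ≤ 1 → δ v p + deg (F d) p ≤ 1 →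
                   Colourable (suc m) G
  extend-through {v} {F} col vx v≢w dv d sv sp = finish (choose (deg (F d) x) refl)
    where
    H-vx : Adj H v x
    H-vx = H-adj v≢w (≢-sym w≢x) vx

    choose : ∀ r → deg (F d) x ≡ r → ∃[ c ] (insert F c (v , x) Colours H × 1 ≤ deg (insert F c (v , x) d) x)
    choose zero eq = d , colours-insert col H-vx joinable ,
      subst (λ P → 1 ≤ deg P x) (≡-sym (insert-same F d (v , x))) (≤-trans (s≤s z≤n) (deg-∷-snd v x (F d)))
      where
      joinable : Joinable (F d) v x
      joinable = sv , ≤-trans (≤-reflexive eq) z≤n ,
        λ l → isolated⇒lab≢ (F d) (linear col d) (≢-sym (Adj⇒≢ G vx)) eq (≡-sym l)
    -- Any colour will do here, as `d` occurs at `x` already. Before `vx` is inserted, `v` has load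
    -- at most two, and `x` has lost both `w` and `v`, so its load is at most `m * 2 ∸ 1`.
    choose (suc r) eq with insert-greedily H col H-vx lt
      where
      dx : suc (degree (delete H v x) x) ≤ m * 2
      dx = ≤-trans (degree-delete-snd H H-vx) (below-max x H-degree-x)
      lt : load F v + load F x < suc m * 2
      lt = s≤s (≤-trans (+-mono-≤ (≤-trans (load≤ col v) dv) (load≤ col x)) (s≤s dx))
    ... | c , col′ = c , col′ , ≤-trans (≤-trans (s≤s z≤n) (≤-reflexive (≡-sym eq))) (deg-insert-≥ F c (v , x) d x)

    finish : ∃[ c ] (insert F c (v , x) Colours H × 1 ≤ deg (insert F c (v , x) d) x) → Colourable (suc m) G
    finish (c , col′ , pos) with spare-colour {F = insert F c (v , x)} (≤-trans (load≤ col′ x) (below-max x H-degree-x)) d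
    ... | inj₂ d≡0 = contradiction (≡-sym d≡0) (<⇒≢ pos)
    -- If `vx` received `d` and `v` is `p`, the degree of `p` in colour `d` went up by one; the term
    -- `δ v p` in the hypothesis provides for this.
    ... | inj₁ (e , e≢d , se) = extend-distinct col′ e≢d se (≤-trans (deg-insert-≤ F c v x d p)
            (≤-trans (≤-reflexive (cong (λ i → i + deg (F d) p) (trans (cong (δ v p +_) (δ-≢ x≢p)) (+-identityʳ _)))) sp))

-- Low-degree neighbours and the induction

Subgraph : ∀ {n} → Graph n → Graph n → Set
Subgraph H G = ∀ {u v} → Adj H u v → Adj G u v

Isolated : ∀ {n} → Graph n → Fin n → Set
Isolated G w = ∀ v → ¬ Adj G w v

degree≤0⇒isolated : ∀ {n} (G : Graph n) {w} → degree G w ≤ 0 → Isolated G w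
degree≤0⇒isolated G {w} d≤0 v wv = contradiction d≤0 (<⇒≱ (count-pos {p = adj G w} wv))

degree-⊆ : ∀ {n} {H G : Graph n} → Subgraph H G → ∀ u → degree H u ≤ degree G u
degree-⊆ {H = H} {G} sub u = count-mono {p = adj H u} {adj G u} λ _ → sub

∧-mono : ∀ {a a′ b b′} → (a ≡ true → a′ ≡ true) → (b ≡ true → b′ ≡ true) → a ∧ b ≡ true → a′ ∧ b′ ≡ true
∧-mono {true} {b = true} f g _ rewrite f refl | g refl = refl

Degenerate-⊆ : ∀ {n t} {H G : Graph n} → Subgraph H G → Degenerate t G → Degenerate t H
Degenerate-⊆ {H = H} {G} sub degen S S≢∅ with degen S S≢∅
... | u , u∈S , d = u , u∈S , ≤-trans
  (count-mono {p = λ v → adj H u v ∧ lookup S v} {λ v → adj G u v ∧ lookup S v} λ v → ∧-mono (sub {u} {v}) id) d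

-- A set containing `u` has `u` as its vertex of low degree; inside any other set the new edge is
-- invisible.
Degenerate-link : ∀ {n t} (G : Graph n) {u v u≢v} → Degenerate t G → degree (link G u v u≢v) u ≤ t →
                  Degenerate t (link G u v u≢v)
Degenerate-link {t = t} G {u} {v} {u≢v} degen du S S≢∅ with lookup S u in eq
... | true  = u , lookup⇒[]= u S eq , ≤-trans
    (count-mono {p = λ s → adj (link G u v u≢v) u s ∧ lookup S s} {adj (link G u v u≢v) u} λ s us → proj₁ (∧-true us)) du
... | false with degen S S≢∅
...   | s , s∈S , d = s , s∈S , ≤-trans
  (count-mono {p = λ r → adj (link G u v u≢v) s r ∧ lookup S r} {λ r → adj G s r ∧ lookup S r} old) d
  where
  old : ∀ r → adj (link G u v u≢v) s r ∧ lookup S r ≡ true → adj G s r ∧ lookup S r ≡ true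
  old r both with ∧-true both
  ... | sr , r∈ with link-adj⁻ G sr
  ... | inj₁ sr′               = cong₂ _∧_ sr′ r∈
  ... | inj₂ (inj₁ (refl , _)) = case trans (≡-sym eq) ([]=⇒lookup s∈S) of λ ()
  ... | inj₂ (inj₂ (_ , refl)) = case trans (≡-sym eq) r∈ of λ ()

-- The three alternatives in `kind` are those handled by `strip`, `colour-slack` and
-- `colour-two-low`.
record Pivot {n : ℕ} (m : ℕ) (G : Graph n) : Set where
  constructor pivot
  field
    {x w} : Fin n
    xw    : Adj G x w
    kind  : degree G w ≤ 2 ⊎ (degree G w ≤ 3 × (degree G x ≤ m * 2 ⊎ ∃[ v ] (v ≢ w × Adj G x v × degree G v ≤ 3)))

-- Let `S` be the set of vertices of degree at least four. If it is nonempty, degeneracy gives `x`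
-- in `S` with at most three neighbours in `S`, hence with one low neighbour, and with two if `x`
-- has degree at least five. If it is empty, every vertex is low.
find-pivot : ∀ {n m} (G : Graph n) → Degenerate 3 G → (∀ u → degree G u ≤ suc (m * 2)) →
             (∀ u → Isolated G u) ⊎ Pivot m G
find-pivot {n} {m} G degen maxdeg with nonempty? (tabulate λ u → ⌊ 4 ≤? degree G u ⌋)
... | yes S≢∅ = inj₂ (from-core (degen S S≢∅))
  where
  S : Subset n
  S = tabulate λ u → ⌊ 4 ≤? degree G u ⌋

  high : ∀ u → lookup S u ≡ true → 4 ≤ degree G u
  high u u∈ with 4 ≤? degree G u | trans (≡-sym (lookup∘tabulate (λ u → ⌊ 4 ≤? degree G u ⌋) u)) u∈
  ... | yes le | _ = le

  low : ∀ u → lookup S u ≡ false → degree G u ≤ 3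
  low u u∉ with 4 ≤? degree G u | trans (≡-sym (lookup∘tabulate (λ u → ⌊ 4 ≤? degree G u ⌋) u)) u∉
  ... | no nle | _ = s≤s⁻¹ (≰⇒> nle)

  low-neighbour : ∀ x u → adj G x u ∧ lookup S u ≡ false → adj G x u ≡ true → degree G u ≤ 3
  low-neighbour x u ¬both xu rewrite xu = low u ¬both

  -- A parity argument: degree exactly four cannot attain the odd bound `suc (j * 2)`, so it is at
  -- most `j * 2`.
  slack : ∀ j d → 4 ≤ d → d ≤ 4 → d ≤ suc (j * 2) → d ≤ j * 2
  slack zero          d 4≤d _   d≤ = contradiction (≤-trans 4≤d d≤) λ { (s≤s ()) }
  slack (suc zero)    d 4≤d _   d≤ = contradiction (≤-trans 4≤d d≤) λ { (s≤s (s≤s (s≤s ()))) }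
  slack (suc (suc j)) d _   d≤4 _  = ≤-trans d≤4 (m≤m+n 4 (j * 2))

  from-core : ∃[ x ] (x ∈ˢ S × degreeIn G S x ≤ 3) → Pivot m G
  from-core (x , x∈S , dS) with count-< {p = λ u → adj G x u ∧ lookup S u} {adj G x}
                                  (≤-trans (s≤s dS) (high x ([]=⇒lookup x∈S)))
  ... | w , w∉ , xw with 5 ≤? degree G x
  ... | no 5≰  = pivot xw (inj₂ (low-neighbour x w w∉ xw ,
                   inj₁ (slack m (degree G x) (high x ([]=⇒lookup x∈S)) (s≤s⁻¹ (≰⇒> 5≰)) (maxdeg x))))
  ... | yes 5≤ with count-<-avoiding {p = adj G x} {λ u → adj G x u ∧ lookup S u} w (≤-trans (s≤s (s≤s dS)) 5≤)
  ...   | v , v≢w , v∉ , xv = pivot xw (inj₂ (low-neighbour x w w∉ xw ,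
                                inj₂ (v , v≢w , xv , low-neighbour x v v∉ xv)))
... | no S≡∅ with any? (λ x → any? (λ w → adj G x w Bool.≟ true))
...   | no none = inj₁ λ u v uv → none (u , v , uv)
...   | yes (x , w , xw) with 2 ≤? degree G x
-- With no second neighbour at `x`, the edge is reversed and `x` itself serves as the vertex of
-- degree at most two.
...     | no 2≰  = inj₂ (pivot (Adj-sym G xw) (inj₁ (≤-trans (s≤s⁻¹ (≰⇒> 2≰)) (s≤s z≤n))))
...     | yes 2≤ with count-<-avoiding {p = adj G x} {λ _ → false} w
                        (subst (λ c → suc c < degree G x) (≡-sym (count-false n)) 2≤)
...       | v , v≢w , _ , xv = inj₂ (pivot xw (inj₂ (low w , inj₂ (v , v≢w , xv , low v))))
  where
  low : ∀ u → degree G u ≤ 3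
  low u with 4 ≤? degree G u in eq
  ... | no nle = s≤s⁻¹ (≰⇒> nle)
  ... | yes _  = contradiction (u , lookup⇒[]= u _ (trans (lookup∘tabulate _ u) (cong ⌊_⌋ eq))) S≡∅

-- The edges at `w` can be reinserted one by one: before each insertion `w` has load at most one and
-- the other end at most `m * 2`, which is below the threshold of `greedy`.
strip : ∀ {n m} (w : Fin n) d (G : Graph n) → d ≤ 2 → degree G w ≤ d → (∀ u → degree G u ≤ suc (m * 2)) →
        ∃[ H ] (Subgraph H G × Isolated H w × (Colourable (suc m) H → Colourable (suc m) G))
strip w zero    G _   dw _ = G , id , degree≤0⇒isolated G dw , id
strip {n} {m} w (suc d) G d≤2 dw maxdeg with any? (λ t → adj G w t Bool.≟ true)
... | no none = G , id , (λ t wt → none (t , wt)) , id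
... | yes (t , wt) with strip w d (delete G w t) (≤-trans (n≤1+n d) d≤2) (s≤s⁻¹ (≤-trans (degree-delete-fst G wt) dw))
                          (λ u → ≤-trans (degree-delete-≤ G w t u) (maxdeg u))
...   | H , sub , iso , colour = H , (λ uv → proj₁ (delete-adj⁻ G (sub uv))) , iso , λ c → insert-last (colour c)
  where
  insert-last : Colourable (suc m) (delete G w t) → Colourable (suc m) G
  insert-last (F , col) = _ , proj₂ (insert-greedily G col wt (s≤s (+-mono-≤ {y = 1}
    (≤-trans (load≤ col w) (s≤s⁻¹ (≤-trans (degree-delete-fst G wt) (≤-trans dw d≤2))))
    (≤-trans (load≤ col t) (s≤s⁻¹ (≤-trans (degree-delete-snd G wt) (maxdeg t)))))))

-- The induction hypothesis `smaller` restricts only the support of `H`, not its edges, so that it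
-- also applies after an edge absent from `G` has been added.
module Step {n m : ℕ} (G : Graph n) (degen : Degenerate 3 G) (maxdeg : ∀ u → degree G u ≤ suc (m * 2))
            (w : Fin n)
            (smaller : ∀ H → (∀ {u v} → Adj H u v → u ≢ w × ∃[ t ] Adj G u t) → Degenerate 3 H →
                       (∀ u → degree H u ≤ suc (m * 2)) → Colourable (suc m) H) where

  colour-⊆ : ∀ H → Subgraph H G → Isolated H w → Colourable (suc m) H
  colour-⊆ H sub iso = smaller H (λ uv → (λ { refl → iso _ uv }) , _ , sub uv) (Degenerate-⊆ {H = H} {G} sub degen)
    (λ u → ≤-trans (degree-⊆ {H = H} {G} sub u) (maxdeg u))

  module _ {x p q : Fin n} (wx : Adj G w x) (wp : Adj G w p) (wq : Adj G w q)
           (x≢p : x ≢ p) (x≢q : x ≢ q) (p≢q : p ≢ q) (dw : degree G w ≤ 3) (3≤dw : 3 ≤ degree G w) where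

    open Star {m} G maxdeg wx wp wq x≢p x≢q p≢q dw

    colour-slack : degree G q ≤ m * 2 → Colourable (suc m) G
    colour-slack dq = extend-slack (proj₂ (colour-⊆ H H-adj⁻ (degree≤0⇒isolated H H-degree-w))) dq

    module _ {v : Fin n} (v≢w : v ≢ w) (xv : Adj G x v) (dv : degree G v ≤ 3) where

      H₀ : Graph n
      H₀ = delete H v x

      vx : Adj G v x
      vx = Adj-sym G xv

      H₀-adj⁻ : Subgraph H₀ G
      H₀-adj⁻ uv = H-adj⁻ (proj₁ (delete-adj⁻ H uv))

      H₀-isolated : Isolated H₀ w
      H₀-isolated t wt = degree≤0⇒isolated H H-degree-w t (proj₁ (delete-adj⁻ H wt))

      H₀-degree-v : degree H₀ v < degree H v
      H₀-degree-v = degree-delete-fst H (H-adj v≢w (≢-sym w≢x) vx)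

      H₀-degree-v≤2 : degree H₀ v ≤ 2
      H₀-degree-v≤2 = s≤s⁻¹ (≤-trans H₀-degree-v (≤-trans (H-degree≤ v) dv))

      H₀-degree-p : degree H₀ p < degree G p
      H₀-degree-p = ≤-trans (s≤s (degree-delete-≤ H v x p)) H-degree-p

      3≤max : 3 ≤ suc (m * 2)
      3≤max = ≤-trans 3≤dw (maxdeg w)

      -- Here `v` has lost both `w` and `x`, so its load is at most one. There are at least two
      -- colours, because `w` has degree three, and so some colour is missing at `v`.
      if-equal : v ≡ p → Colourable (suc m) G
      if-equal refl with colour-⊆ H₀ H₀-adj⁻ H₀-isolated
      ... | F , col with pigeonhole (λ c → deg (F c) v) 1 few
        where
        2≤k : ∀ j → 3 ≤ suc (j * 2) → 2 ≤ suc j * 1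
        2≤k zero    (s≤s ())
        2≤k (suc j) _ = s≤s (s≤s z≤n)
        few : load F v < suc m * 1
        few = ≤-trans (s≤s (≤-trans (load≤ col v) (s≤s⁻¹ (≤-trans H₀-degree-v (s≤s⁻¹ (≤-trans H-degree-p dv)))))) (2≤k m 3≤max)
      ... | d , lt = extend-through col vx v≢w H₀-degree-v≤2 d (≤-trans (s≤s⁻¹ lt) z≤n)
                       (+-mono-≤ (ind≤1 ⌊ v ≟ p ⌋) (s≤s⁻¹ lt))

      -- Let `c` be the colour of `vp`. As `c` occurs at `p`, a spare colour `d` other than `c`
      -- exists there; and `v` has load at most two, one unit of which is `c`.
      if-adjacent : v ≢ p → Adj G v p → Colourable (suc m) G
      if-adjacent v≢p vp = finish (colour-⊆ H₀ H₀-adj⁻ H₀-isolated)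
        where
        finish : Colourable (suc m) H₀ → Colourable (suc m) G
        finish (F , col) with covers col (delete-adj⁺ H (H-adj v≢w (≢-sym w≢p) vp) (Joins-star v≢p (≢-sym x≢p)))
        ... | c , j with spare-colour {F = F} (≤-trans (load≤ col p) (below-max p H₀-degree-p)) c
        ... | inj₂ c≡0 = contradiction (≡-sym c≡0) (<⇒≢ (joined⇒deg-pos (F c) (Joined-sym j)))
        ... | inj₁ (d , d≢c , sp) = extend-through col vx v≢w H₀-degree-v≤2 d sv
                (≤-trans (≤-reflexive (cong (_+ deg (F d) p) (δ-≢ v≢p))) sp)
          where
          sv : deg (F d) v ≤ 1
          sv = +-cancelʳ-≤ 1 _ _ (begin
            deg (F d) v + 1            ≤⟨ +-monoʳ-≤ (deg (F d) v) (joined⇒deg-pos (F c) j) ⟩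
            deg (F d) v + deg (F c) v  ≤⟨ two-terms≤∑ (λ c → deg (F c) v) d≢c ⟩
            load F v                   ≤⟨ load≤ col v ⟩
            degree H₀ v                ≤⟨ H₀-degree-v≤2 ⟩
            2                          ∎)
            where open ≤-Reasoning

      -- The added edge respects all hypotheses: `v` has degree at most three in `L`, which also
      -- settles degeneracy, and `p` has lost `w`. A colour occurs at most twice at a vertex, so
      -- deleting `vp` leaves its colour at most once at `v` and at `p`.
      if-nonadjacent : v ≢ p → ¬ Adj G v p → Colourable (suc m) G
      if-nonadjacent v≢p ¬vp = finish (smaller L support (Degenerate-link H₀ {u≢v = v≢p} (Degenerate-⊆ {H = H₀} {G} H₀-adj⁻ degen) dLv) maxdegL)
        where
        L : Graph n
        L = link H₀ v p v≢p

        dLv : degree L v ≤ 3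
        dLv = ≤-trans (degree-link-≤ H₀ v) (s≤s H₀-degree-v≤2)

        support : ∀ {u t} → Adj L u t → u ≢ w × ∃[ s ] Adj G u s
        support ut with link-adj⁻ H₀ ut
        ... | inj₁ ut′               = (λ { refl → H₀-isolated _ ut′ }) , _ , H₀-adj⁻ ut′
        ... | inj₂ (inj₁ (refl , _)) = v≢w , _ , vx
        ... | inj₂ (inj₂ (refl , _)) = ≢-sym w≢p , _ , Adj-sym G wp

        maxdegL : ∀ u → degree L u ≤ suc (m * 2)
        maxdegL u with u ≟ v | u ≟ p
        ... | yes refl | _        = ≤-trans dLv 3≤max
        ... | no _     | yes refl = ≤-trans (degree-link-≤ H₀ u) (≤-trans H₀-degree-p (maxdeg u))
        ... | no u≢v   | no u≢p   = ≤-trans (degree-link-off H₀ u≢v u≢p)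
                                      (≤-trans (degree-⊆ {H = H₀} {G} H₀-adj⁻ u) (maxdeg u))

        finish : Colourable (suc m) L → Colourable (suc m) G
        finish (F , col) with covers col (link-adj H₀)
        ... | c , j = extend-through (colours-unlink col (λ vp → ¬vp (H₀-adj⁻ vp))) vx v≢w H₀-degree-v≤2 c
          (s≤s⁻¹ (≤-trans (deg-remove (F c) j) (Linear⇒deg≤2 (F c) (linear col c) v)))
          (≤-trans (≤-reflexive (cong (_+ deg (remove v p (F c)) p) (δ-≢ v≢p)))
            (s≤s⁻¹ (≤-trans (subst (λ P → suc (deg P p) ≤ deg (F c) p) (remove-comm p v (F c)) (deg-remove (F c) (Joined-sym j)))
              (Linear⇒deg≤2 (F c) (linear col c) p))))

      colour-two-low : Colourable (suc m) G
      colour-two-low with v ≟ p | adj G v p Bool.≟ true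
      ... | yes v≡p | _      = if-equal v≡p
      ... | no v≢p  | yes vp = if-adjacent v≢p vp
      ... | no v≢p  | no ¬vp = if-nonadjacent v≢p ¬vp

-- The set `A` contains all non-isolated vertices, and each recursive call takes the pivot `w` out
-- of it.
colourable : ∀ {n m} fuel (G : Graph n) (A : Fin n → Bool) → count A ≤ fuel → (∀ {u v} → Adj G u v → A u ≡ true) →
             Degenerate 3 G → (∀ u → degree G u ≤ suc (m * 2)) → Colourable (suc m) G
colourable {n} {m} fuel G A size support degen maxdeg with find-pivot {m = m} G degen maxdeg
... | inj₁ isolated = (λ _ → []) , record
  { linear = λ _ → tt
  ; covers = λ {u} {v} uv → contradiction uv (isolated u v)
  ; load≤  = λ u → subst (_≤ degree G u) (≡-sym (trans (∑-const (suc m) 0) (*-zeroʳ (suc m)))) z≤n }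
colourable zero G A size support degen maxdeg | inj₂ (pivot xw _) =
  contradiction size (<⇒≱ (count-pos {p = A} (support xw)))
colourable {n} {m} (suc fuel) G A size support degen maxdeg | inj₂ (pivot {x} {w} xw kind) = by-kind kind
  where
  wx : Adj G w x
  wx = Adj-sym G xw

  A′ : Fin n → Bool
  A′ u = A u ∧ not ⌊ u ≟ w ⌋

  A′-w : A′ w ≡ false
  A′-w with w ≟ w
  ... | yes _ rewrite support wx = refl
  ... | no w≢w = contradiction refl w≢w

  A′⁺ : ∀ {u} → u ≢ w → A u ≡ true → A′ u ≡ true
  A′⁺ {u} u≢w eq rewrite eq with u ≟ w
  ... | yes u≡w = contradiction u≡w u≢w
  ... | no _    = refl

  smaller : ∀ H → (∀ {u v} → Adj H u v → u ≢ w × ∃[ t ] Adj G u t) → Degenerate 3 H →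
            (∀ u → degree H u ≤ suc (m * 2)) → Colourable (suc m) H
  smaller H sub = colourable fuel H A′
    (s≤s⁻¹ (≤-trans (count-mono-< {p = A′} {A} w A′-w (support wx) λ u A′u → proj₁ (∧-true A′u)) size))
    λ uv → let (u≢w , _ , ut) = sub uv in A′⁺ u≢w (support ut)

  open Step {m = m} G degen maxdeg w smaller

  by-low : degree G w ≤ 2 → Colourable (suc m) G
  by-low dw with strip {m = m} w 2 G ≤-refl dw maxdeg
  ... | H , sub , iso , extend = extend (colour-⊆ H sub iso)

  by-kind : degree G w ≤ 2 ⊎ (degree G w ≤ 3 × (degree G x ≤ m * 2 ⊎ ∃[ v ] (v ≢ w × Adj G x v × degree G v ≤ 3))) →
            Colourable (suc m) G
  by-kind (inj₁ dw) = by-low dw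
  by-kind (inj₂ (dw , rest)) with 3 ≤? degree G w
  ... | no 3≰ = by-low (s≤s⁻¹ (≰⇒> 3≰))
  -- The degree of `w` is now exactly three, and `p` and `q` are its neighbours besides `x`.
  ... | yes 3≤ with count-<-avoiding {p = adj G w} {λ _ → false} x
                      (subst (λ c → suc c < degree G w) (≡-sym (count-false n)) (≤-trans (s≤s (s≤s z≤n)) 3≤))
  ... | p , p≢x , _ , wp with count-<-avoiding {p = adj G w} {λ u → ⌊ u ≟ p ⌋} x (≤-trans (s≤s (s≤s one)) 3≤)
    where
    one : count (λ u → ⌊ u ≟ p ⌋) ≤ 1
    one = subst (λ c → count (λ u → ⌊ u ≟ p ⌋) ≤ suc c) (count-false n) (count-mono-bump p other)
      where
      other : ∀ u → u ≢ p → ⌊ u ≟ p ⌋ ≡ true → false ≡ true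
      other u u≢p eq with u ≟ p
      ... | yes u≡p = contradiction u≡p u≢p
  ... | q , q≢x , q≢ᵇp , wq with q ≟ p
  ... | no q≢p = three rest
    where
    three : degree G x ≤ m * 2 ⊎ ∃[ v ] (v ≢ w × Adj G x v × degree G v ≤ 3) → Colourable (suc m) G
    -- The pivot's `x` is the vertex with slack, so it takes the place of the neighbour whose edge
    -- is inserted last.
    three (inj₁ dx) = colour-slack wp wq wx (≢-sym q≢p) p≢x q≢x dw 3≤ dx
    three (inj₂ (v , v≢w , xv , dv)) = colour-two-low wx wp wq (≢-sym p≢x) (≢-sym q≢x) (≢-sym q≢p) dw 3≤ v≢w xv dv

-- From colour classes to an edge colouring

first : ∀ {m} → (Fin (suc m) → Bool) → Fin (suc m)
-- If `f` holds nowhere, as for a pair joined in no class, the search ends at the last colour by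
-- default.
first {zero}  f = zero
first {suc m} f = if f zero then zero else suc (first (f ∘ suc))

-- This makes the colouring symmetric: `uv` and `vu` are joined in the same classes.
first-cong : ∀ {m} {f g : Fin (suc m) → Bool} → (∀ c → f c ≡ g c) → first f ≡ first g
first-cong {zero}  f≗g = refl
first-cong {suc m} f≗g = cong₂ (λ b c → if b then zero else suc c) (f≗g zero) (first-cong (f≗g ∘ suc))

first-holds : ∀ {m} (f : Fin (suc m) → Bool) {c} → f c ≡ true → f (first f) ≡ true
first-holds {zero}  f {zero} fc = fc
first-holds {suc m} f {c} fc with f zero in f0
... | true = f0
first-holds {suc m} f {zero}  fc | false = case trans (≡-sym f0) fc of λ ()
first-holds {suc m} f {suc c} fc | false = first-holds (f ∘ suc) fc

module _ {n m : ℕ} {G : Graph n} {F : Classes (suc m) n} (col : F Colours G) where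

  colouring : EdgeColoring G (suc m)
  colouring .EdgeColoring.col u v     = first λ c → ⌊ joined? (F c) u v ⌋
  colouring .EdgeColoring.col-sym u v = first-cong λ c →
    ⌊⌋-cong (joined? (F c) u v) (joined? (F c) v u) Joined-sym Joined-sym

  colouring-joins : ∀ {u v} → Adj G u v → Joined (F (EdgeColoring.col colouring u v)) u v
  colouring-joins {u} {v} uv with covers col uv
  ... | c , j = ⌊⌋-true⁻ (joined? (F (EdgeColoring.col colouring u v)) u v)
                  (first-holds (λ c → ⌊ joined? (F c) u v ⌋) (⌊⌋-true⁺ (joined? (F c) u v) j))

  colouring-linear : IsLinearColoring colouring
  colouring-linear = degrees , acyclic
    where
    degrees : ∀ c u → colorDegree colouring c u ≤ 2
    degrees c u = ≤-trans (count≤deg (F c) u same) (Linear⇒deg≤2 (F c) (linear col c) u)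
      where
      same : ∀ v → adj G u v ∧ ⌊ EdgeColoring.col colouring u v ≟ c ⌋ ≡ true → Joined (F c) u v
      same v eq = let (uv , cᵇ) = ∧-true {adj G u v} eq in
        subst (λ c → Joined (F c) u v) (⌊⌋-true⁻ (EdgeColoring.col colouring u v ≟ c) cᵇ) (colouring-joins uv)

    acyclic : ∀ c vs → ¬ MonoCycle colouring c vs
    acyclic c vs (3≤ , unique , mono) = Linear⇒acyclic (F c) (linear col c) vs 3≤ unique
      (All.map (λ { (uv , refl) → colouring-joins uv }) mono)

theorem1 : ∀ (k : ℕ) → 1 ≤ k → ∀ (n : ℕ) (G : Graph n) →
    Degenerate 3 G → MaxDegree≤ G (2 * k ∸ 1) → HasLinearColoring G k
theorem1 (suc m) _ n G degen maxdeg = colouring (proj₂ coloured) , colouring-linear (proj₂ coloured)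
  where
  maxdeg′ : ∀ u → degree G u ≤ suc (m * 2)
  -- The bound `2 * suc m ∸ 1` computes to `m + suc (m + 0)`.
  maxdeg′ u = subst (degree G u ≤_) (trans (+-suc m (m + 0)) (cong suc (*-comm 2 m))) (maxdeg u)

  coloured : Colourable (suc m) G
  coloured = colourable (count {n} λ _ → true) G (λ _ → true) ≤-refl (λ _ → refl) degen maxdeg′
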